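{- Let $\mathcal D\in\{\mathsf{sSet}^{\leq n}_+,\mathsf{sSet}^{\leq n},\mathsf{sSet}_+,\mathsf{sSet}\}$. For each Lawvere-Tierney topology $j^w$ on $\mathcal D$, the full subcategory $\mathsf{Sep}_{j^w}$ of $\mathcal D$ on the $j^w$-separated objects and the full subcategory $\mathsf{Sh}_{j^w}$ of $\mathcal D$ on the $j^w$-sheaves are quasitoposes.
   Context: A quasitopos is a category that has all finite limits and finite colimits, is cartesian closed and locally cartesian closed, and has a strong-subobject classifier (a subobject classifier for the class of strong monomorphisms). $\mathbb N$ contains $0$. $\Delta$ is the simplex category: objects $k\in\mathbb N$ ($k$ standing for the ordinal $\{0<\dots<k\}$), monotone maps; $\Delta_+$ is the wide subcategory of injective monotone maps; $\Delta^{\leq n}$ and $\Delta^{\leq n}_+$ are their full subcategories on $0,\dots,n$. In the opposite category, $d_i=d^k_i\colon k\to k-1$ is the opposite of the injection omitting $i$, and $s_i=s^k_i\colon k\to k+1$ is the opposite of the monotone surjection hitting $i$ twice ($0\le i\le k$). $\mathsf{sSet},\mathsf{sSet}_+,\mathsf{sSet}^{\leq n},\mathsf{sSet}^{\leq n}_+$ are the categories of presheaves of sets on $\Delta,\Delta_+,\Delta^{\leq n},\Delta^{\leq n}_+$. In each, $y$ is the Yoneda embedding, $\Omega(k)$ is the Heyting algebra of subpresheaves of $y(k)$, and $\Omega(f)$ (for $f\colon k\to l$ in the opposite index category) is pullback along $y(f^{\mathrm{op}})\colon y(l)\to y(k)$. A (Lawvere-Tierney) topology is a natural transformation $j\colon\Omega\to\Omega$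 that, at each $k$, preserves the top element, is idempotent, and preserves binary meets. Topologies $j^w$. (a) On $\mathsf{sSet}^{\leq n}_+$, $w=w_0\cdots w_n\in\{0,1\}^{n+1}$ (write $y_+,\Omega_+$ for $y,\Omega$). $y_+(k)^\partial$ is the union of the faces of $y_+(k)$, the $i$-th face being the least subpresheaf containing $d^k_i$; $y_+(0)^\partial=\emptyset$. The incidence tuple of $x\in\Omega_+(k+1)$ is $(\Omega_+(d_{k+1})(x),\dots,\Omega_+(d_0)(x))$. For $n=0$, $\Omega_+(0)=\{\emptyset,y_+(0)\}$, $j^0$ is the identity and $j^1$ is constant with value $y_+(0)$. Given $j^w$ with $w\in\{0,1\}^{n+1}$ and a bit $b$, put $j=j^{wb}$ with $j_k=j^w_k$ for $k\le n$, and: $j_{n+1}(y_+(n+1))=y_+(n+1)$; $j_{n+1}(y_+(n+1)^\partial)=y_+(n+1)^\partial$ if $b=0$ and $=y_+(n+1)$ if $b=1$; for $x<y_+(n+1)^\partial$ let $\vec z=(j_n\Omega_+(d_{n+1})(x),\dots,j_n\Omega_+(d_0)(x))$. If $\vec z\ne(y_+(n),\dots,y_+(n))$, $j_{n+1}(x)$ is the unique element with incidence tuple $\vec z$; otherwise $j_{n+1}(x)=y_+(n+1)^\partial$ if $b=0$ and $=y_+(n+1)$ if $b=1$. (b) On $\mathsf{sSet}^{\leq n}$, $w=0^m1^{n+1-m}$, $0\le m\le n+1$: $j^w_k:=F_kj^w_kF_k^{ -1}$ with the right-hand $j^w$ from (a), where $F_k\colon\Omega_+(k)\to\Omega(k)$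 is the bijection $F_k(x)(l)=x(l)\cup\mathrm{degen}(x,l)$, $\mathrm{degen}(x,0)=\emptyset$, $\mathrm{degen}(x,l+1)=\{s^l_i\circ f\mid f\in x(l)\cup\mathrm{degen}(x,l),0\le i\le l\}$. (c) On $\mathsf{sSet}_+$, $w\in\{0,1\}^\omega$, and on $\mathsf{sSet}$, $w\in\{0^\omega\}\cup\{0^m1^\omega\mid m\in\mathbb N\}$: $j^w_k:=j^{w_0\cdots w_k}_k$, the topology of the $k$-dimensional version, $\Omega(k)$ being identified with that of the $k$-dimensional version by restriction to dimensions $\le k$. These are all the topologies on the respective categories. Closure: for $A'\subseteq A$, let $\chi^{A'}\colon A\to\Omega$ be its characteristic map, $\chi^{A'}_k(a)(l)=\{f\in y(k)(l)\mid A(f)(a)\in A'(l)\}$ (viewing $f$ as a morphism $k\to l$ of the opposite index category). The $j$-closure $\overline{A'}\subseteq A$ is given by $a\in\overline{A'}(k)\iff j_k(\chi^{A'}_k(a))=y(k)$. $A'\subseteq A$ is $j$-dense if $\overline{A'}=A$. $B$ is $j$-separated (resp. $j$-complete) if for every $j$-dense $A'\subseteq A$ and every morphism $f\colon A'\to B$ there is at most one (resp. at least one) morphism $g\colon A\to B$ with $g|_{A'}=f$; $B$ is a $j$-sheaf if it is both. -}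

module Defs where

open import Level using (Level; 0ℓ; _⊔_) renaming (suc to lsuc)
open import Axiom.ExcludedMiddle using (ExcludedMiddle)
open import Data.Bool.Base using (Bool; true; false; if_then_else_)
open import Data.Empty using (⊥)
open import Data.Fin.Base as Fin using (Fin; zero; suc; toℕ; inject₁; inject≤; fromℕ; punchIn; pinch)
open import Data.Fin.Properties using (punchIn-injective; punchIn-mono-≤; pinch-mono-≤)
import Data.Fin.Properties as Finₚ
open import Data.Nat.Base as ℕ using (ℕ; zero; suc; _≤ᵇ_; s≤s; z≤n)
import Data.Nat.Properties as ℕₚ
open import Data.Product.Base using (Σ; Σ-syntax; ∃; ∃-syntax; _×_; _,_; proj₁; proj₂)
open import Data.Product using (∃!)
open import Data.Sum.Base using (_⊎_; inj₁; inj₂)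
open import Data.Unit.Base using (tt) renaming (⊤ to Unit)
open import Data.Vec.Functional using (Vector; init; last)
open import Function.Base using (id; _∘′_)
open import Function.Bundles using (Func; _⟨$⟩_; Inverse; _↔_)
open import Function.Definitions using (Injective)
import Function.Construct.Identity as Identity
import Function.Construct.Composition as Composition
import Function.Relation.Binary.Setoid.Equality as Func≈
open import Relation.Binary.Bundles using (Setoid)
open import Relation.Binary.Definitions using (Monotonic₁; tri<; tri≈; tri>)
open import Relation.Binary.PropositionalEquality as ≡ using (_≡_; _≢_; refl; cong)
open import Relation.Binary.Structures using (IsEquivalence)
open import Relation.Nullary.Decidable.Core using (yes; no; does)
open import Relation.Nullary.Negation.Core using (contradiction)
open import Relation.Unary using (Pred; _≐_)

private variable
  o ℓ e o′ ℓ′ e′ : Level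

record Category (o ℓ e : Level) : Set (lsuc (o ⊔ ℓ ⊔ e)) where
  infix  4 _≈_ _⇒_
  infixr 9 _∘_
  field
    Ob        : Set o
    _⇒_       : Ob → Ob → Set ℓ
    _≈_       : ∀ {A B} → A ⇒ B → A ⇒ B → Set e
    id⇒       : ∀ {A} → A ⇒ A
    _∘_       : ∀ {A B C} → B ⇒ C → A ⇒ B → A ⇒ C
    equiv     : ∀ {A B} → IsEquivalence (_≈_ {A} {B})
    assoc     : ∀ {A B C D} {f : A ⇒ B} {g : B ⇒ C} {h : C ⇒ D} → (h ∘ g) ∘ f ≈ h ∘ (g ∘ f)
    identityˡ : ∀ {A B} {f : A ⇒ B} → id⇒ ∘ f ≈ f
    identityʳ : ∀ {A B} {f : A ⇒ B} → f ∘ id⇒ ≈ f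
    ∘-resp-≈  : ∀ {A B C} {f f′ : B ⇒ C} {g g′ : A ⇒ B} → f ≈ f′ → g ≈ g′ → f ∘ g ≈ f′ ∘ g′

  module Equiv {A B} = IsEquivalence (equiv {A} {B})

  hom-setoid : Ob → Ob → Setoid ℓ e
  hom-setoid A B = record { Carrier = A ⇒ B ; _≈_ = _≈_ ; isEquivalence = equiv }

op : Category o ℓ e → Category o ℓ e
op C = record
  { Ob = Ob ; _⇒_ = λ A B → B ⇒ A ; _≈_ = _≈_ ; id⇒ = id⇒ ; _∘_ = λ f g → g ∘ f
  ; equiv = equiv ; assoc = Equiv.sym assoc
  ; identityˡ = identityʳ ; identityʳ = identityˡ
  ; ∘-resp-≈ = λ p q → ∘-resp-≈ q p }
  where open Category C

FullSubcategory : (C : Category o ℓ e) {p : Level} → Pred (Category.Ob C) p → Category (o ⊔ p) ℓ e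
FullSubcategory C P = record
  { Ob = Σ Ob P ; _⇒_ = λ A B → proj₁ A ⇒ proj₁ B ; _≈_ = _≈_ ; id⇒ = id⇒ ; _∘_ = _∘_
  ; equiv = equiv ; assoc = assoc ; identityˡ = identityˡ ; identityʳ = identityʳ
  ; ∘-resp-≈ = ∘-resp-≈ }
  where open Category C

Slice : (C : Category o ℓ e) → Category.Ob C → Category (o ⊔ ℓ) (ℓ ⊔ e) e
Slice C A = record
  { Ob = Σ[ X ∈ Ob ] X ⇒ A
  ; _⇒_ = λ (X , f) (Y , g) → Σ[ h ∈ X ⇒ Y ] g ∘ h ≈ f
  ; _≈_ = λ h k → proj₁ h ≈ proj₁ k
  ; id⇒ = id⇒ , identityʳ
  ; _∘_ = λ (k , q) (h , p) →
      k ∘ h , Equiv.trans (Equiv.sym assoc) (Equiv.trans (∘-resp-≈ q Equiv.refl) p)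
  ; equiv = record { refl = Equiv.refl ; sym = Equiv.sym ; trans = Equiv.trans }
  ; assoc = assoc ; identityˡ = identityˡ ; identityʳ = identityʳ ; ∘-resp-≈ = ∘-resp-≈ }
  where open Category C

record Functor (C : Category o ℓ e) (D : Category o′ ℓ′ e′) : Set (o ⊔ ℓ ⊔ e ⊔ o′ ⊔ ℓ′ ⊔ e′) where
  private
    module C = Category C
    module D = Category D
  field
    F₀           : C.Ob → D.Ob
    F₁           : ∀ {A B} → A C.⇒ B → F₀ A D.⇒ F₀ B
    identity     : ∀ {A} → F₁ (C.id⇒ {A}) D.≈ D.id⇒
    homomorphism : ∀ {X Y Z} {f : X C.⇒ Y} {g : Y C.⇒ Z} → F₁ (g C.∘ f) D.≈ F₁ g D.∘ F₁ f
    F-resp-≈     : ∀ {A B} {f g : A C.⇒ B} → f C.≈ g → F₁ f D.≈ F₁ g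

opF : {C : Category o ℓ e} {D : Category o′ ℓ′ e′} → Functor C D → Functor (op C) (op D)
opF F = record
  { F₀ = F₀ ; F₁ = F₁ ; identity = identity ; homomorphism = homomorphism ; F-resp-≈ = F-resp-≈ }
  where open Functor F

record NaturalTransformation {C : Category o ℓ e} {D : Category o′ ℓ′ e′}
                             (F G : Functor C D) : Set (o ⊔ ℓ ⊔ ℓ′ ⊔ e′) where
  private
    module C = Category C
    module D = Category D
    module F = Functor F
    module G = Functor G
  field
    η       : ∀ X → F.F₀ X D.⇒ G.F₀ X
    commute : ∀ {X Y} (f : X C.⇒ Y) → η Y D.∘ F.F₁ f D.≈ G.F₁ f D.∘ η X

Functors : Category o ℓ e → Category o′ ℓ′ e′ →
           Category (o ⊔ ℓ ⊔ e ⊔ o′ ⊔ ℓ′ ⊔ e′) (o ⊔ ℓ ⊔ ℓ′ ⊔ e′) (o ⊔ e′)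
Functors C D = record
  { Ob = Functor C D
  ; _⇒_ = NaturalTransformation
  ; _≈_ = λ α β → ∀ X → η α X ≈ η β X
  ; id⇒ = record
      { η = λ _ → id⇒
      ; commute = λ _ → Equiv.trans identityˡ (Equiv.sym identityʳ) }
  ; _∘_ = λ β α → record
      { η = λ X → η β X ∘ η α X
      ; commute = λ f →
          Equiv.trans assoc
          (Equiv.trans (∘-resp-≈ Equiv.refl (commute α f))
          (Equiv.trans (Equiv.sym assoc)
          (Equiv.trans (∘-resp-≈ (commute β f) Equiv.refl) assoc))) }
  ; equiv = record
      { refl = λ _ → Equiv.refl
      ; sym = λ p X → Equiv.sym (p X)
      ; trans = λ p q X → Equiv.trans (p X) (q X) }
  ; assoc = λ _ → assoc
  ; identityˡ = λ _ → identityˡ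
  ; identityʳ = λ _ → identityʳ
  ; ∘-resp-≈ = λ p q X → ∘-resp-≈ (p X) (q X) }
  where
    open Category D
    open NaturalTransformation

module _ (C : Category o ℓ e) where
  open Category C

  record Terminal : Set (o ⊔ ℓ ⊔ e) where
    field
      obj      : Ob
      !        : ∀ {X} → X ⇒ obj
      !-unique : ∀ {X} (f : X ⇒ obj) → ! ≈ f

  record Product (A B : Ob) : Set (o ⊔ ℓ ⊔ e) where
    field
      obj      : Ob
      π₁       : obj ⇒ A
      π₂       : obj ⇒ B
      ⟨_,_⟩    : ∀ {X} → X ⇒ A → X ⇒ B → X ⇒ obj
      project₁ : ∀ {X} {f : X ⇒ A} {g : X ⇒ B} → π₁ ∘ ⟨ f , g ⟩ ≈ f
      project₂ : ∀ {X} {f : X ⇒ A} {g : X ⇒ B} → π₂ ∘ ⟨ f , g ⟩ ≈ g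
      unique   : ∀ {X} {f : X ⇒ A} {g : X ⇒ B} {h : X ⇒ obj} →
                 π₁ ∘ h ≈ f → π₂ ∘ h ≈ g → ⟨ f , g ⟩ ≈ h

  record Exponential (A B : Ob) : Set (o ⊔ ℓ ⊔ e) where
    field
      obj     : Ob
      product : Product obj A
      eval    : Product.obj product ⇒ B
      curry   : ∀ {X} (X×A : Product X A) (g : Product.obj X×A ⇒ B) →
                ∃! _≈_ λ (h : X ⇒ obj) →
                  eval ∘ Product.⟨_,_⟩ product (h ∘ Product.π₁ X×A) (Product.π₂ X×A) ≈ g

  record CartesianClosed : Set (o ⊔ ℓ ⊔ e) where
    field
      terminal     : Terminal
      products     : ∀ A B → Product A B
      exponentials : ∀ A B → Exponential A B

  Mono Epi StrongMono : ∀ {A B} → A ⇒ B → Set (o ⊔ ℓ ⊔ e)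
  Mono {A} m = ∀ {X} (f g : X ⇒ A) → m ∘ f ≈ m ∘ g → f ≈ g
  Epi {_} {B} q = ∀ {X} (f g : B ⇒ X) → f ∘ q ≈ g ∘ q → f ≈ g
  StrongMono {A} {B} m =
    Mono m ×
    (∀ {X Y} (q : X ⇒ Y) → Epi q → (u : X ⇒ A) (v : Y ⇒ B) → m ∘ u ≈ v ∘ q →
       Σ[ d ∈ Y ⇒ A ] (d ∘ q ≈ u × m ∘ d ≈ v))

  --   P --p₂--> B
  --   |p₁       |g
  --   A --f---> D
  IsPullback : ∀ {P A B D} → P ⇒ A → P ⇒ B → A ⇒ D → B ⇒ D → Set (o ⊔ ℓ ⊔ e)
  IsPullback {P} {A} {B} p₁ p₂ f g =
    f ∘ p₁ ≈ g ∘ p₂ ×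
    (∀ {X} (a : X ⇒ A) (b : X ⇒ B) → f ∘ a ≈ g ∘ b →
       ∃! _≈_ λ (u : X ⇒ P) → p₁ ∘ u ≈ a × p₂ ∘ u ≈ b)

  record StrongSubobjectClassifier : Set (o ⊔ ℓ ⊔ e) where
    field
      terminal : Terminal
    open Terminal terminal using (!) renaming (obj to 𝟙)
    field
      Ω        : Ob
      truth    : 𝟙 ⇒ Ω
      classify : ∀ {A B} (m : A ⇒ B) → StrongMono m →
                 ∃! _≈_ λ (χ : B ⇒ Ω) → IsPullback m ! χ truth

module _ {J : Category o′ ℓ′ e′} {C : Category o ℓ e} (D : Functor J C) where
  private module J = Category J
  open Category C
  open Functor D

  record Cone : Set (o ⊔ ℓ ⊔ e ⊔ o′ ⊔ ℓ′) where
    field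
      apex    : Ob
      leg     : ∀ X → apex ⇒ F₀ X
      commute : ∀ {X Y} (f : X J.⇒ Y) → F₁ f ∘ leg X ≈ leg Y

  record Limit : Set (o ⊔ ℓ ⊔ e ⊔ o′ ⊔ ℓ′) where
    field
      cone      : Cone
      universal : (K : Cone) →
                  ∃! _≈_ λ (u : Cone.apex K ⇒ Cone.apex cone) →
                    ∀ X → Cone.leg cone X ∘ u ≈ Cone.leg K X

Colimit : {J : Category o′ ℓ′ e′} {C : Category o ℓ e} → Functor J C → Set (o ⊔ ℓ ⊔ e ⊔ o′ ⊔ ℓ′)
Colimit D = Limit (opF D)

record FiniteCategory (J : Category 0ℓ 0ℓ 0ℓ) : Set where
  open Category J
  field
    ∣Ob∣  : ℕ
    ob    : Ob ↔ Fin ∣Ob∣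
    ∣hom∣ : Ob → Ob → ℕ
    hom   : ∀ A B → Inverse (hom-setoid A B) (≡.setoid (Fin (∣hom∣ A B)))

record Quasitopos (C : Category o ℓ e) : Set (lsuc 0ℓ ⊔ o ⊔ ℓ ⊔ e) where
  field
    finiteLimits   : (J : Category 0ℓ 0ℓ 0ℓ) → FiniteCategory J → (D : Functor J C) → Limit D
    finiteColimits : (J : Category 0ℓ 0ℓ 0ℓ) → FiniteCategory J → (D : Functor J C) → Colimit D
    cartesianClosed           : CartesianClosed C
    locallyCartesianClosed    : ∀ A → CartesianClosed (Slice C A)
    strongSubobjectClassifier : StrongSubobjectClassifier C

-- Setoids play the role of sets: types with _≡_ lack the quotients needed for
-- colimits.
Setoids : Category (lsuc 0ℓ) 0ℓ 0ℓ
Setoids = record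
  { Ob = Setoid 0ℓ 0ℓ
  ; _⇒_ = Func
  ; _≈_ = λ {A} {B} → Func≈._≈_ A B
  ; id⇒ = λ {A} → Identity.function A
  ; _∘_ = λ g f → Composition.function f g
  ; equiv = λ {A} {B} → Func≈.isEquivalence A B
  ; assoc = λ {_} {_} {_} {D} _ → Setoid.refl D
  ; identityˡ = λ {_} {B} _ → Setoid.refl B
  ; identityʳ = λ {_} {B} _ → Setoid.refl B
  ; ∘-resp-≈ = λ {_} {_} {C} {f} {_} {_} {g′} p q x →
      Setoid.trans C (Func.cong f (q x)) (p (g′ ⟨$⟩ x)) }

module _ (C : Category 0ℓ 0ℓ 0ℓ) where
  private module C = Category C

  Presheaves : Category (lsuc 0ℓ) 0ℓ 0ℓ
  Presheaves = Functors (op C) Setoids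

  Presheaf : Set₁
  Presheaf = Category.Ob Presheaves

  y : C.Ob → Presheaf
  y k = record
    { F₀ = λ l → C.hom-setoid l k
    ; F₁ = λ f → record
        { to = λ g → g C.∘ f
        ; cong = λ p → C.∘-resp-≈ p C.Equiv.refl }
    ; identity = λ _ → C.identityʳ
    ; homomorphism = λ _ → C.Equiv.sym C.assoc
    ; F-resp-≈ = λ p _ → C.∘-resp-≈ C.Equiv.refl p }

module _ {C : Category 0ℓ 0ℓ 0ℓ} where
  private module C = Category C

  module _ (A : Presheaf C) where
    open Functor A

    El : C.Ob → Set
    El k = Setoid.Carrier (F₀ k)

    record Subpresheaf : Set₁ where
      field
        mem      : ∀ k → Pred (El k) 0ℓ
        respects : ∀ {k} {a b : El k} → Setoid._≈_ (F₀ k) a b → mem k a → mem k b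
        restrict : ∀ {k l} (f : l C.⇒ k) {a : El k} → mem k a → mem l (F₁ f ⟨$⟩ a)

  open Subpresheaf public

  infix 4 _≐ˢ_
  _≐ˢ_ : {A : Presheaf C} → Subpresheaf A → Subpresheaf A → Set
  S ≐ˢ T = ∀ k → mem S k ≐ mem T k

  ⊤ˢ ⊥ˢ : {A : Presheaf C} → Subpresheaf A
  ⊤ˢ = record { mem = λ _ _ → Unit ; respects = λ _ _ → tt ; restrict = λ _ _ → tt }
  ⊥ˢ = record { mem = λ _ _ → ⊥ ; respects = λ _ () ; restrict = λ _ () }

  ⋃ˢ : {A : Presheaf C} {I : Set} → (I → Subpresheaf A) → Subpresheaf A
  ⋃ˢ S = record
    { mem = λ k a → ∃[ i ] mem (S i) k a
    ; respects = λ p (i , q) → i , respects (S i) p q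
    ; restrict = λ f (i , q) → i , restrict (S i) f q }

  ⌊_⌋ : {A : Presheaf C} → Subpresheaf A → Presheaf C
  ⌊_⌋ {A} S = record
    { F₀ = λ k → record
        { Carrier = Σ (El A k) (mem S k)
        ; _≈_ = λ a b → Setoid._≈_ (F₀ k) (proj₁ a) (proj₁ b)
        ; isEquivalence = record
            { refl = Setoid.refl (F₀ k)
            ; sym = Setoid.sym (F₀ k)
            ; trans = Setoid.trans (F₀ k) } }
    ; F₁ = λ f → record
        { to = λ (a , p) → F₁ f ⟨$⟩ a , restrict S f p
        ; cong = Func.cong (F₁ f) }
    ; identity = λ (a , _) → identity a
    ; homomorphism = λ (a , _) → homomorphism a
    ; F-resp-≈ = λ p (a , _) → F-resp-≈ p a }
    where open Functor A

  inclusion : {A : Presheaf C} (S : Subpresheaf A) → Category._⇒_ (Presheaves C) ⌊ S ⌋ A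
  inclusion {A} S = record
    { η = λ k → record { to = proj₁ ; cong = λ p → p }
    ; commute = λ {_} {l} _ _ → Setoid.refl (Functor.F₀ A l) }

  -- The least subpresheaf of y(k) containing f.
  ⟨_⟩ˢ : ∀ {k l} → l C.⇒ k → Subpresheaf (y C k)
  ⟨ f ⟩ˢ = record
    { mem = λ _ g → ∃[ h ] f C.∘ h C.≈ g
    ; respects = λ p (h , q) → h , C.Equiv.trans q p
    ; restrict = λ g (h , q) →
        h C.∘ g , C.Equiv.trans (C.Equiv.sym C.assoc) (C.∘-resp-≈ q C.Equiv.refl) }

-- The set Ω(k), with equality _≐ˢ_.
Ω : (C : Category 0ℓ 0ℓ 0ℓ) → Category.Ob C → Set₁
Ω C k = Subpresheaf (y C k)

module _ {C : Category 0ℓ 0ℓ 0ℓ} where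
  open Category C

  Ω₁ : ∀ {k l} → l ⇒ k → Ω C k → Ω C l
  Ω₁ f x = record
    { mem = λ m g → mem x m (f ∘ g)
    ; respects = λ p → respects x (∘-resp-≈ Equiv.refl p)
    ; restrict = λ g p → respects x assoc (restrict x g p) }

  χ : {A : Presheaf C} → Subpresheaf A → ∀ k → El A k → Ω C k
  χ {A} A′ k a = record
    { mem = λ l f → mem A′ l (F₁ f ⟨$⟩ a)
    ; respects = λ p → respects A′ (F-resp-≈ p a)
    ; restrict = λ {l} {m} g {f} p →
        respects A′ (Setoid.sym (F₀ m) (homomorphism a)) (restrict A′ g p) }
    where open Functor A

module _ (C : Category 0ℓ 0ℓ 0ℓ) (j : ∀ k → Ω C k → Ω C k) where
  private module P = Category (Presheaves C)

  _∈closure_ : {A : Presheaf C} {k : Category.Ob C} → El A k → Subpresheaf A → Set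
  _∈closure_ {k = k} a A′ = j k (χ A′ k a) ≐ˢ ⊤ˢ

  Dense : {A : Presheaf C} → Subpresheaf A → Set
  Dense {A} A′ = ∀ k (a : El A k) → a ∈closure A′

  Separated Complete Sheaf : Presheaf C → Set₁
  Separated B =
    ∀ {A : Presheaf C} (A′ : Subpresheaf A) → Dense A′ → (f : ⌊ A′ ⌋ P.⇒ B) (g h : A P.⇒ B) →
    g P.∘ inclusion A′ P.≈ f → h P.∘ inclusion A′ P.≈ f → g P.≈ h
  Complete B =
    ∀ {A : Presheaf C} (A′ : Subpresheaf A) → Dense A′ → (f : ⌊ A′ ⌋ P.⇒ B) →
    Σ[ g ∈ A P.⇒ B ] g P.∘ inclusion A′ P.≈ f
  Sheaf B = Separated B × Complete B

  Sep Sh : Category (lsuc 0ℓ) 0ℓ 0ℓ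
  Sep = FullSubcategory (Presheaves C) Separated
  Sh  = FullSubcategory (Presheaves C) Sheaf

record Monotone (k l : ℕ) : Set where
  constructor monotone
  field
    fun  : Fin (suc k) → Fin (suc l)
    mono : Monotonic₁ Fin._≤_ Fin._≤_ fun

open Monotone public

Δ : Category 0ℓ 0ℓ 0ℓ
Δ = record
  { Ob = ℕ
  ; _⇒_ = Monotone
  ; _≈_ = λ f g → ∀ i → fun f i ≡ fun g i
  ; id⇒ = monotone id id
  ; _∘_ = λ g f → monotone (fun g ∘′ fun f) (mono g ∘′ mono f)
  ; equiv = record
      { refl = λ _ → refl ; sym = λ p i → ≡.sym (p i) ; trans = λ p q i → ≡.trans (p i) (q i) }
  ; assoc = λ _ → refl
  ; identityˡ = λ _ → refl
  ; identityʳ = λ _ → refl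
  ; ∘-resp-≈ = λ {_} {_} {_} {f} {_} {_} {g′} p q i → ≡.trans (cong (fun f) (q i)) (p (fun g′ i)) }

Δ₊ : Category 0ℓ 0ℓ 0ℓ
Δ₊ = record
  { Ob = ℕ
  ; _⇒_ = λ k l → Σ[ f ∈ k Δ.⇒ l ] Injective _≡_ _≡_ (fun f)
  ; _≈_ = λ f g → proj₁ f Δ.≈ proj₁ g
  ; id⇒ = Δ.id⇒ , id
  ; _∘_ = λ (g , p) (f , q) → g Δ.∘ f , λ r → q (p r)
  ; equiv = record
      { refl = λ _ → refl ; sym = λ p i → ≡.sym (p i) ; trans = λ p q i → ≡.trans (p i) (q i) }
  ; assoc = λ _ → refl
  ; identityˡ = λ _ → refl
  ; identityʳ = λ _ → refl
  ; ∘-resp-≈ = λ {_} {_} {_} {f} {f′} {g} {g′} →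
      Δ.∘-resp-≈ {f = proj₁ f} {proj₁ f′} {proj₁ g} {proj₁ g′} }
  where module Δ = Category Δ

Δ≤ Δ₊≤ : ℕ → Category 0ℓ 0ℓ 0ℓ
Δ≤  n = FullSubcategory Δ  (ℕ._≤ n)
Δ₊≤ n = FullSubcategory Δ₊ (ℕ._≤ n)

private
  module Δ  = Category Δ
  module Δ₊ = Category Δ₊

Ω₊ : ℕ → Set₁
Ω₊ = Ω Δ₊

-- The monotone maps whose opposites are d_i and s_i.
δ : ∀ {k} → Fin (suc (suc k)) → k Δ₊.⇒ suc k
δ i = monotone (punchIn i) (λ {a} {b} → punchIn-mono-≤ i a b) , λ {a} {b} → punchIn-injective i a b

σ : ∀ {k} → Fin (suc k) → suc k Δ.⇒ k
σ i = monotone (pinch i) (pinch-mono-≤ i)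

-- y₊(k+1)^∂
∂ : ∀ k → Ω₊ (suc k)
∂ k = ⋃ˢ λ i → ⟨ δ i ⟩ˢ

-- F_k(x)(l) is the union of face x l, i.e. x(l) as a subset of y(k)(l), and degen x l.
degen : ∀ {k} → Ω₊ k → ∀ l → Pred (l Δ.⇒ k) 0ℓ
face  : ∀ {k} → Ω₊ k → ∀ l → Pred (l Δ.⇒ k) 0ℓ

face x l f = ∃[ g ] mem x l g × proj₁ g Δ.≈ f

degen x zero    f = ⊥
degen x (suc l) f = ∃[ g ] ∃[ i ] (face x l g ⊎ degen x l g) × g Δ.∘ σ i Δ.≈ f

private
  δσ : ∀ {n} (i : Fin n) (t : Fin (suc n)) →
       punchIn (suc i) (pinch i t) ≡ t ⊎ (t ≡ suc i × punchIn (suc i) (pinch i t) ≡ inject₁ i)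
  δσ zero    zero          = inj₁ refl
  δσ zero    (suc zero)    = inj₂ (refl , refl)
  δσ zero    (suc (suc t)) = inj₁ refl
  δσ (suc i) zero          = inj₁ refl
  δσ (suc i) (suc t) with δσ i t
  ... | inj₁ p       = inj₁ (cong suc p)
  ... | inj₂ (p , q) = inj₂ (cong suc p , cong suc q)

  strict : ∀ {n m} (f : Fin (suc n) → Fin m) → Monotonic₁ Fin._≤_ Fin._≤_ f →
           (∀ i → f (inject₁ i) ≢ f (suc i)) → Monotonic₁ Fin._<_ Fin._<_ f
  strict f f-mono f-≢ {i} {suc j} (s≤s i≤j) =
    ℕₚ.≤-<-trans
      (f-mono (≡.subst (toℕ i ℕ.≤_) (≡.sym (Finₚ.toℕ-inject₁ j)) i≤j))
      (Finₚ.≤∧≢⇒< (f-mono (≡.subst (ℕ._≤ suc (toℕ j)) (≡.sym (Finₚ.toℕ-inject₁ j)) (ℕₚ.n≤1+n _)))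
                  (f-≢ j))

  strict⇒injective : ∀ {n m} (f : Fin n → Fin m) → Monotonic₁ Fin._<_ Fin._<_ f → Injective _≡_ _≡_ f
  strict⇒injective f f-strict {i} {j} fi≡fj with ℕₚ.<-cmp (toℕ i) (toℕ j)
  ... | tri< i<j _ _ = contradiction fi≡fj (Finₚ.<⇒≢ (f-strict i<j))
  ... | tri≈ _ i≡j _ = Finₚ.toℕ-injective i≡j
  ... | tri> _ _ j<i = contradiction (≡.sym fi≡fj) (Finₚ.<⇒≢ (f-strict j<i))

  injective⊎degenerate : ∀ {l m} (f : suc l Δ.⇒ m) →
    Injective _≡_ _≡_ (fun f) ⊎ ∃[ g ] ∃[ i ] g Δ.∘ σ i Δ.≈ f
  injective⊎degenerate f with Finₚ.any? (λ i → fun f (inject₁ i) Finₚ.≟ fun f (suc i))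
  ... | no ¬p = inj₁ (strict⇒injective (fun f) (strict (fun f) (mono f) λ i p → ¬p (i , p)))
  ... | yes (i , fi≡fi+1) = inj₂ (f Δ.∘ proj₁ (δ (suc i)) , i , agrees)
    where
    agrees : f Δ.∘ proj₁ (δ (suc i)) Δ.∘ σ i Δ.≈ f
    agrees t with δσ i t
    ... | inj₁ p          = cong (fun f) p
    ... | inj₂ (refl , q) = ≡.trans (cong (fun f) q) fi≡fi+1

  -- The elements of F_k(x) are exactly the g ∘ f with g ∈ x.
  generated : ∀ {k m} (x : Ω₊ k) {g : m Δ₊.⇒ k} → mem x m g → ∀ {l} (f : l Δ.⇒ m) →
              face x l (proj₁ g Δ.∘ f) ⊎ degen x l (proj₁ g Δ.∘ f)
  generated x {g} p {zero} f = inj₁ (g Δ₊.∘ f₊ , restrict x f₊ p , λ _ → refl)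
    where
    f₊ : zero Δ₊.⇒ _
    f₊ = f , λ { {zero} {zero} _ → refl }
  generated x {g} p {suc l} f with injective⊎degenerate f
  ... | inj₁ f-inj = inj₁ (g Δ₊.∘ (f , f-inj) , restrict x (f , f-inj) p , λ _ → refl)
  ... | inj₂ (h , i , hσ≈f) =
    inj₂ (proj₁ g Δ.∘ h , i , generated x p h , λ t → cong (fun (proj₁ g)) (hσ≈f t))

  generators : ∀ {k} (x : Ω₊ k) {l} {f : l Δ.⇒ k} → face x l f ⊎ degen x l f →
               ∃[ m ] Σ[ g ∈ m Δ₊.⇒ k ] mem x m g × ∃[ h ] proj₁ g Δ.∘ h Δ.≈ f
  generators x (inj₁ (g , p , g≈f)) = _ , g , p , Δ.id⇒ , g≈f
  generators x {suc l} (inj₂ (f′ , i , q , f′σ≈f)) with generators x q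
  ... | m , g , p , h , gh≈f′ =
    m , g , p , h Δ.∘ σ i , λ t → ≡.trans (gh≈f′ _) (f′σ≈f t)

  F-respects : ∀ {k} (x : Ω₊ k) {l} {f f′ : l Δ.⇒ k} → f Δ.≈ f′ →
               face x l f ⊎ degen x l f → face x l f′ ⊎ degen x l f′
  F-respects x p (inj₁ (g , q , r)) = inj₁ (g , q , λ t → ≡.trans (r t) (p t))
  F-respects x {suc l} p (inj₂ (g , i , q , r)) = inj₂ (g , i , q , λ t → ≡.trans (r t) (p t))

F : ∀ k → Ω₊ k → Ω Δ k
F k x = record
  { mem      = λ l f → face x l f ⊎ degen x l f
  ; respects = F-respects x
  ; restrict = λ f p →
      let _ , g , q , h , gh≈ = generators x p
      in F-respects x (λ t → gh≈ (fun f t)) (generated x {g} q (h Δ.∘ f)) }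

module Topologies (lem : ∀ {ℓ} → ExcludedMiddle ℓ) where

  -- Definite description; the first argument is a junk value, returned only
  -- if there is no witness.
  the : ∀ {a p} {A : Set a} → A → Pred A p → A
  the junk P with lem {P = ∃ P}
  ... | yes (a , _) = a
  ... | no  _       = junk

  -- Since y₊(k) has no elements in dimensions > k, Ω₊(k) is the same set for
  -- Δ₊ and for all Δ₊≤ n with k ≤ n, and j^{w₀⋯wₙ}_k depends only on w₀⋯w_k.
  -- So the recursion is carried out on Δ₊, with w = w₀⋯w_k at stage k.
  j₊ : ∀ k → Vector Bool (suc k) → Ω₊ k → Ω₊ k
  j₊ zero    w x = if w zero then ⊤ˢ else x
  j₊ (suc n) w x =
    if does (lem {P = x ≐ˢ ⊤ˢ}) then ⊤ˢ
    else if does (lem {P = x ≐ˢ ∂ n}) then top-or-∂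
    else if does (lem {P = ∀ i → z i ≐ˢ ⊤ˢ}) then top-or-∂
    else the ⊥ˢ (λ u → ∀ i → Ω₁ (δ i) u ≐ˢ z i)
    where
    top-or-∂ : Ω₊ (suc n)
    top-or-∂ = if last w then ⊤ˢ else ∂ n

    z : Fin (suc (suc n)) → Ω₊ n
    z i = j₊ n (init w) (Ω₁ (δ i) x)

  jΔ : ∀ k → Vector Bool (suc k) → Ω Δ k → Ω Δ k
  jΔ k w x = F k (j₊ k w (the ⊥ˢ λ x₊ → F k x₊ ≐ˢ x))

  -- Restriction to dimensions ≤ n is a bijection Ω(k) → Ω≤ⁿ(k) for k ≤ n.
  module _ {C : Category 0ℓ 0ℓ 0ℓ} {P : Pred (Category.Ob C) 0ℓ} where

    truncate : ∀ {k} (p : P k) → Ω C k → Ω (FullSubcategory C P) (k , p)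
    truncate p x = record
      { mem = λ l → mem x (proj₁ l) ; respects = respects x ; restrict = restrict x }

    untruncate : ∀ {k} (p : P k) → Ω (FullSubcategory C P) (k , p) → Ω C k
    untruncate p x = the ⊥ˢ λ x′ → truncate p x′ ≐ˢ x

data Kind : Set where
  sSet₊≤ sSet≤ : ℕ → Kind
  sSet₊  sSet  : Kind

index : Kind → Category 0ℓ 0ℓ 0ℓ
index (sSet₊≤ n) = Δ₊≤ n
index (sSet≤ n)  = Δ≤ n
index sSet₊      = Δ₊
index sSet       = Δ

data StepWord : Set where
  0^ω    : StepWord
  0^_1^ω : ℕ → StepWord

Word : Kind → Set
Word (sSet₊≤ n) = Vector Bool (suc n)
Word (sSet≤ n)  = Fin (suc (suc n))    -- m stands for 0^m 1^{n+1-m}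
Word sSet₊      = ℕ → Bool
Word sSet       = StepWord

letter : StepWord → ℕ → Bool
letter 0^ω        _ = false
letter (0^ m 1^ω) i = m ≤ᵇ i

prefix : (ℕ → Bool) → ∀ k → Vector Bool (suc k)
prefix w k i = w (toℕ i)

module _ (lem : ∀ {ℓ} → ExcludedMiddle ℓ) where
  open Topologies lem

  j^ : (𝒟 : Kind) → Word 𝒟 → ∀ k → Ω (index 𝒟) k → Ω (index 𝒟) k
  j^ (sSet₊≤ n) w (k , k≤n) x =
    truncate k≤n (j₊ k (λ i → w (inject≤ i (s≤s k≤n))) (untruncate k≤n x))
  j^ (sSet≤ n)  m (k , k≤n) x =
    truncate k≤n (jΔ k (prefix (letter (0^ toℕ m 1^ω)) k) (untruncate k≤n x))
  j^ sSet₊      w k x = j₊ k (prefix w k) x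
  j^ sSet       w k x = jΔ k (prefix (letter w) k) x

{-# OPTIONS --safe #-}
module Submission where

-- For a topology j^w let W be the set of objects m with w_m = 0. Unwinding the recursion
-- for j^w, a sieve x on k satisfies j^w(x) = y(k) iff x contains every morphism to k from
-- an object of W; on Δ this uses that w has the form 0^m 1^…, so that a degenerate element
-- in a dimension of W is the degeneracy of one in a dimension of W. Hence a subpresheaf is
-- dense iff it contains all elements at objects of W. An object is separated (a sheaf) iff
-- its elements embed into (correspond to) the compatible families of elements indexed by
-- the morphisms from W. Limits and slice exponentials are then inherited from presheaves,
-- colimits are obtained by reflection, where sheafification is the presheaf of compatible
-- families, and the strong subobjects are the subobjects determined by their elements at
-- objects of W, so they are classified by the sieves of morphisms from W.

open import Defs
open import Axiom.ExcludedMiddle using (ExcludedMiddle)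
open import Data.Product.Base using (_×_)

open import Level using (Level; 0ℓ) renaming (suc to lsuc)
open import Data.Bool.Base using (Bool; true; false; T)
open import Data.Bool.Properties using (T-≡)
open import Data.Fin.Base
  using (Fin; zero; suc; toℕ; inject₁; inject≤; fromℕ; fromℕ<; pinch; punchIn; punchOut)
open import Data.Fin.Properties
  using (any?; all?; _≟_; injective⇒≤; suc-injective; punchInᵢ≢i; punchIn-punchOut;
         punchOut-injective; punchOut-mono-≤; toℕ-fromℕ; toℕ-fromℕ<; toℕ-inject₁; toℕ-inject≤;
         toℕ-injective; toℕ<n)
open import Data.Fin.Relation.Unary.Top using (view; ‵fromℕ; ‵inject₁)
open import Data.Nat.Base using (ℕ; zero; suc; _≤_; _<_; _≤ᵇ_; s≤s; s≤s⁻¹)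
open import Data.Nat.Properties using (≤-trans; n≤1+n; ≤ᵇ⇒≤; ≤⇒≤ᵇ; <⇒≱)
open import Data.Product.Base using (Σ-syntax; ∃; ∃-syntax; _,_; proj₁; proj₂; swap)
open import Data.Product using (∃!)
open import Data.Sum.Base using (_⊎_; inj₁; inj₂)
open import Data.Unit.Base using (tt) renaming (⊤ to Unit)
open import Data.Vec.Functional using (Vector; init)
open import Function.Base using (id)
open import Function.Bundles using (Func; _⟨$⟩_; _⇔_; mk⇔; Equivalence)
open import Function.Construct.Composition using (_⇔-∘_)
open import Function.Definitions using (Injective)
open import Relation.Binary.Bundles using (Setoid)
import Relation.Binary.Construct.Closure.Equivalence as Closure
open import Relation.Binary.PropositionalEquality as ≡ using (_≡_; _≢_; cong; subst)
open import Relation.Nullary.Decidable.Core using (yes; no; ¬?; isYes; toWitness; fromWitness)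
open import Relation.Nullary.Negation.Core using (¬_; contradiction)
open import Relation.Unary using (Pred)

private variable
  o ℓ e : Level

-- Exponentials relative to chosen products, and the slice over a terminal object.

module _ (C : Category o ℓ e) where
  open Category C

  -- Any product of `X` and `A` is isomorphic to the chosen one, so currying against the chosen
  -- products carries over to all of them.
  exponential : (products : ∀ A B → Product C A B) {A B : Ob} (E : Ob) →
                let open module × A B = Product (products A B) in
                (eval : obj E A ⇒ B) →
                (∀ {X} (g : obj X A ⇒ B) →
                   ∃! _≈_ λ (h : X ⇒ E) → eval ∘ ⟨_,_⟩ E A (h ∘ π₁ X A) (π₂ X A) ≈ g) →
                Exponential C A B
  exponential products {A} {B} E eval curry = record
    { obj = E ; product = products E A ; eval = eval ; curry = curry′ }
    where
    open module × A B = Product (products A B)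
    curry′ : ∀ {X} (X×A : Product C X A) (g : Product.obj X×A ⇒ B) →
             ∃! _≈_ λ (h : X ⇒ E) →
               eval ∘ ⟨_,_⟩ E A (h ∘ Product.π₁ X×A) (Product.π₂ X×A) ≈ g
    curry′ {X} X×A g with curry (g ∘ Product.⟨_,_⟩ X×A (π₁ X A) (π₂ X A))
    ... | h , p , h-unique = h , β , η
      where
      module P = Product X×A
      to : P.obj ⇒ obj X A
      to = ⟨_,_⟩ X A P.π₁ P.π₂
      from : obj X A ⇒ P.obj
      from = P.⟨ π₁ X A , π₂ X A ⟩
      from∘to : from ∘ to ≈ id⇒
      from∘to = Equiv.trans (Equiv.sym (P.unique
          (Equiv.trans (Equiv.sym assoc)
            (Equiv.trans (∘-resp-≈ P.project₁ Equiv.refl) (project₁ X A)))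
          (Equiv.trans (Equiv.sym assoc)
            (Equiv.trans (∘-resp-≈ P.project₂ Equiv.refl) (project₂ X A)))))
        (P.unique identityʳ identityʳ)
      pair-∘ : ∀ {Y Z} {u : Z ⇒ Y} {a : Y ⇒ E} {b : Y ⇒ A} →
               ⟨_,_⟩ E A (a ∘ u) (b ∘ u) ≈ ⟨_,_⟩ E A a b ∘ u
      pair-∘ = unique E A
        (Equiv.trans (Equiv.sym assoc) (∘-resp-≈ (project₁ E A) Equiv.refl))
        (Equiv.trans (Equiv.sym assoc) (∘-resp-≈ (project₂ E A) Equiv.refl))
      pair-cong : ∀ {Y} {a a′ : Y ⇒ E} {b b′ : Y ⇒ A} → a ≈ a′ → b ≈ b′ →
                  ⟨_,_⟩ E A a b ≈ ⟨_,_⟩ E A a′ b′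
      pair-cong p q = unique E A
        (Equiv.trans (project₁ E A) (Equiv.sym p)) (Equiv.trans (project₂ E A) (Equiv.sym q))
      β : eval ∘ ⟨_,_⟩ E A (h ∘ P.π₁) P.π₂ ≈ g
      β = Equiv.trans
        (∘-resp-≈ Equiv.refl (Equiv.trans
          (pair-cong
            (Equiv.trans (∘-resp-≈ Equiv.refl (Equiv.sym (project₁ X A))) (Equiv.sym assoc))
            (Equiv.sym (project₂ X A)))
          pair-∘))
        (Equiv.trans (Equiv.sym assoc) (Equiv.trans (∘-resp-≈ p Equiv.refl)
        (Equiv.trans assoc (Equiv.trans (∘-resp-≈ Equiv.refl from∘to) identityʳ))))
      η : ∀ {h′ : X ⇒ E} → eval ∘ ⟨_,_⟩ E A (h′ ∘ P.π₁) P.π₂ ≈ g → h ≈ h′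
      η q = h-unique (Equiv.trans
        (∘-resp-≈ Equiv.refl (Equiv.trans
          (pair-cong (Equiv.trans (∘-resp-≈ Equiv.refl (Equiv.sym P.project₁)) (Equiv.sym assoc))
                     (Equiv.sym P.project₂))
          pair-∘))
        (Equiv.trans (Equiv.sym assoc) (∘-resp-≈ q Equiv.refl)))

  Slice-terminal : ∀ A → Terminal (Slice C A)
  Slice-terminal A = record
    { obj = A , id⇒
    ; ! = λ {(_ , f)} → f , identityˡ
    ; !-unique = λ (_ , p) → Equiv.trans (Equiv.sym p) identityˡ }

  module _ (terminal : Terminal C) where
    open Terminal terminal renaming (obj to 𝟙)

    private
      _≈!_ : ∀ {X} (f g : X ⇒ 𝟙) → f ≈ g
      f ≈! g = Equiv.trans (Equiv.sym (!-unique f)) (!-unique g)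

    Slice-product⇒product : ∀ {A B} {a : A ⇒ 𝟙} {b : B ⇒ 𝟙} →
                            Product (Slice C 𝟙) (A , a) (B , b) → Product C A B
    Slice-product⇒product P = record
      { obj = proj₁ P.obj
      ; π₁ = proj₁ P.π₁
      ; π₂ = proj₁ P.π₂
      ; ⟨_,_⟩ = λ f g → proj₁ (P.⟨_,_⟩ {_ , !} (f , (_ ≈! _)) (g , (_ ≈! _)))
      ; project₁ = P.project₁
      ; project₂ = P.project₂
      ; unique = λ {_} {f} {g} {h} p q →
          P.unique {_ , !} {f , (_ ≈! _)} {g , (_ ≈! _)} {h , (_ ≈! _)} p q }
      where module P = Product P

    product⇒Slice-product : ∀ {A B} (a : A ⇒ 𝟙) (b : B ⇒ 𝟙) →
                            Product C A B → Product (Slice C 𝟙) (A , a) (B , b)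
    product⇒Slice-product a b P = record
      { obj = P.obj , !
      ; π₁ = P.π₁ , (_ ≈! _)
      ; π₂ = P.π₂ , (_ ≈! _)
      ; ⟨_,_⟩ = λ (f , _) (g , _) → P.⟨ f , g ⟩ , (_ ≈! _)
      ; project₁ = P.project₁
      ; project₂ = P.project₂
      ; unique = P.unique }
      where module P = Product P

    -- Every triangle over `𝟙` commutes, so the slice over `𝟙` is equivalent to `C`.
    Slice-closed⇒closed : CartesianClosed (Slice C 𝟙) → CartesianClosed C
    Slice-closed⇒closed S = record
      { terminal = terminal
      ; products = λ A B → Slice-product⇒product (S.products (A , !) (B , !))
      ; exponentials = λ A B → record
          { obj = proj₁ (E.obj A B)
          ; product = Slice-product⇒product (E.product A B)
          ; eval = proj₁ (E.eval A B)
          ; curry = λ X×A g →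
              let (h , _) , p , h-unique =
                    E.curry A B (product⇒Slice-product ! ! X×A) (g , (_ ≈! _))
              in h
               , Equiv.trans (∘-resp-≈ Equiv.refl (Slice-unique (E.product A B))) p
               , λ {h′} q → h-unique {h′ , (_ ≈! _)}
                   (Equiv.trans (∘-resp-≈ Equiv.refl (Equiv.sym (Slice-unique (E.product A B)))) q) } }
      where
      module S = CartesianClosed S
      module E A B = Exponential (S.exponentials (A , !) (B , !))
      -- Pairing in the slice takes commutativity proofs as arguments; up to `_≈_` the resulting map
      -- does not depend on them.
      Slice-unique : ∀ {A B X} {a : A ⇒ 𝟙} {b : B ⇒ 𝟙} {x : X ⇒ 𝟙}
                     (P : Product (Slice C 𝟙) (A , a) (B , b)) → let module P = Product P in
                     {f : X ⇒ A} {g : X ⇒ B} {p : a ∘ f ≈ x} {q : b ∘ g ≈ x} →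
                     Product.⟨_,_⟩ (Slice-product⇒product P) f g ≈
                     proj₁ (P.⟨_,_⟩ {_ , x} (f , p) (g , q))
      Slice-unique P = Product.unique (Slice-product⇒product P)
        (Product.project₁ P) (Product.project₂ P)

-- Presheaves through their elements, with restriction as a right action.

module Elements (C : Category 0ℓ 0ℓ 0ℓ) (A : Presheaf C) where
  private module C = Category C
  open Functor A

  infix  4 _≈_
  infixl 9 _·_

  _≈_ : ∀ {k} → El A k → El A k → Set
  _≈_ {k} = Setoid._≈_ (F₀ k)

  refl : ∀ {k} {x : El A k} → x ≈ x
  refl {k} = Setoid.refl (F₀ k)

  sym : ∀ {k} {x y : El A k} → x ≈ y → y ≈ x
  sym {k} = Setoid.sym (F₀ k)

  trans : ∀ {k} {x y z : El A k} → x ≈ y → y ≈ z → x ≈ z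
  trans {k} = Setoid.trans (F₀ k)

  _·_ : ∀ {k l} → El A k → l C.⇒ k → El A l
  x · f = F₁ f ⟨$⟩ x

  ·-congˡ : ∀ {k l} {x y : El A k} (f : l C.⇒ k) → x ≈ y → x · f ≈ y · f
  ·-congˡ f = Func.cong (F₁ f)

  ·-congʳ : ∀ {k l} (x : El A k) {f g : l C.⇒ k} → f C.≈ g → x · f ≈ x · g
  ·-congʳ x p = F-resp-≈ p x

  ·-id : ∀ {k} (x : El A k) → x · C.id⇒ ≈ x
  ·-id = identity

  ·-∘ : ∀ {k l m} (x : El A k) (f : l C.⇒ k) (g : m C.⇒ l) → x · f · g ≈ x · (f C.∘ g)
  ·-∘ x f g = sym (homomorphism x)

module Morphism (C : Category 0ℓ 0ℓ 0ℓ) {A B : Presheaf C}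
                (h : Category._⇒_ (Presheaves C) A B) where
  private
    module C = Category C
    module A = Elements C A
    module B = Elements C B
  open NaturalTransformation h

  infix 10 $_
  $_ : ∀ {k} → El A k → El B k
  $_ {k} x = η k ⟨$⟩ x

  $-cong : ∀ {k} {x y : El A k} → x A.≈ y → $ x B.≈ $ y
  $-cong {k} = Func.cong (η k)

  $-· : ∀ {k l} (x : El A k) (f : l C.⇒ k) → $ (x A.· f) B.≈ $ x B.· f
  $-· x f = commute f x

-- The topology whose covering sieves are those containing every morphism out of
-- an object of W.
module Local (C : Category 0ℓ 0ℓ 0ℓ) (W : Pred (Category.Ob C) 0ℓ) where
  open Category C
  private
    module P = Category (Presheaves C)

  -- Local objects in terms of compatible families.

  IsSeparated : Presheaf C → Set
  IsSeparated A = let open Elements C A renaming (_≈_ to _≈ᴬ_) in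
    ∀ {k} {x y : El A k} → (∀ {m} → W m → (f : m ⇒ k) → x · f ≈ᴬ y · f) → x ≈ᴬ y

  -- A natural transformation from `y(k)` to `A`, both restricted to the full subcategory on `W`.
  -- Proofs of `W` are not assumed unique; `at-cong` makes the values independent of them.
  record Family (A : Presheaf C) (k : Ob) : Set where
    private module A = Elements C A
    field
      at       : ∀ {m} → W m → m ⇒ k → El A m
      at-cong  : ∀ {m} (v w : W m) {f g : m ⇒ k} → f ≈ g → at v f A.≈ at w g
      at-·     : ∀ {l m} (v : W l) (w : W m) (f : l ⇒ k) (g : m ⇒ l) → at v f A.· g A.≈ at w (f ∘ g)

  open Family

  IsComplete : Presheaf C → Set
  IsComplete A = let open Elements C A renaming (_≈_ to _≈ᴬ_) in
    ∀ {k} (s : Family A k) → Σ[ x ∈ El A k ] (∀ {m} (w : W m) (f : m ⇒ k) → x · f ≈ᴬ at s w f)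

  -- Separated objects for c = false, sheaves for c = true.
  record IsLocal (c : Bool) (A : Presheaf C) : Set where
    field
      separated : IsSeparated A
      complete  : T c → IsComplete A

  -- Sheafification, the separated quotient and the reflection.

  Family-map : ∀ {A B k} → A P.⇒ B → Family A k → Family B k
  Family-map {A} {B} h s = record
    { at = λ w f → h.$ at s w f
    ; at-cong = λ v w p → h.$-cong (at-cong s v w p)
    ; at-· = λ v w f g → B.trans (B.sym (h.$-· _ g)) (h.$-cong (at-· s v w f g)) }
    where
    module B = Elements C B
    module h = Morphism C h

  -- The right Kan extension of the restriction of `A` to the full subcategory on `W`. At an object
  -- of `W` a family is determined by its value at the identity, so there `families A` agrees with
  -- `A`.
  families : Presheaf C → Presheaf C
  families A = record
    { F₀ = λ k → record
        { Carrier = Family A k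
        ; _≈_ = λ s t → ∀ {m} (w : W m) (f : m ⇒ k) → at s w f A.≈ at t w f
        ; isEquivalence = record
            { refl = λ _ _ → A.refl
            ; sym = λ p w f → A.sym (p w f)
            ; trans = λ p q w f → A.trans (p w f) (q w f) } }
    ; F₁ = λ h → record
        { to = λ s → record
            { at = λ w f → at s w (h ∘ f)
            ; at-cong = λ v w p → at-cong s v w (∘-resp-≈ Equiv.refl p)
            ; at-· = λ v w f g → A.trans (at-· s v w (h ∘ f) g) (at-cong s w w assoc) }
        ; cong = λ p w f → p w (h ∘ f) }
    ; identity = λ s w f → at-cong s w w identityˡ
    ; homomorphism = λ s w f → at-cong s w w assoc
    ; F-resp-≈ = λ p s w f → at-cong s w w (∘-resp-≈ p Equiv.refl) }
    where module A = Elements C A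

  restrictions : ∀ A → A P.⇒ families A
  restrictions A = record
    { η = λ k → record
        { to = λ x → record
            { at = λ _ f → x · f
            ; at-cong = λ _ _ → ·-congʳ x
            ; at-· = λ _ _ → ·-∘ x }
        ; cong = λ p _ f → ·-congˡ f p }
    ; commute = λ g x _ f → ·-∘ x g f }
    where open Elements C A

  -- The value of a family at `f` is the value at the identity of its restriction along `f`. Hence
  -- restrictions from `W` separate families, and a family of families is glued by evaluating each
  -- member at the identity.
  families-local : ∀ {c} A → IsLocal c (families A)
  families-local A = record
    { separated = λ {_} {s} {t} p w f →
        A.trans (at-cong s w w (Equiv.sym identityʳ))
        (A.trans (p w f w id⇒) (at-cong t w w identityʳ))
    ; complete = λ _ s → record
        { at = λ w f → at (at s w f) w id⇒
        ; at-cong = λ v w p →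
            A.trans (at-cong (at s v _) v w Equiv.refl) (at-cong s v w p w id⇒)
        ; at-· = λ v w f g → A.trans (at-· (at s v f) v w id⇒ g)
            (A.trans (at-cong (at s v f) w w (Equiv.trans identityˡ (Equiv.sym identityʳ)))
                     (at-· s v w f g w id⇒)) }
        , λ w f v g → A.trans (A.sym (at-· s w v f g v id⇒)) (at-cong (at s w f) v v identityʳ) }
    where module A = Elements C A

  -- Coarsening the equality takes a quotient: it identifies exactly the elements that no morphism
  -- to a separated presheaf can tell apart.
  separate : Presheaf C → Presheaf C
  separate A = record
    { F₀ = λ k → record
        { Carrier = El A k
        ; _≈_ = λ x y → ∀ {m} → W m → (f : m ⇒ k) → x · f ≈ᴬ y · f
        ; isEquivalence = record
            { refl = λ _ _ → refl
            ; sym = λ p w f → sym (p w f)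
            ; trans = λ p q w f → trans (p w f) (q w f) } }
    ; F₁ = λ g → record
        { to = _· g
        ; cong = λ {x} {y} p w f → trans (·-∘ x g f) (trans (p w (g ∘ f)) (sym (·-∘ y g f))) }
    ; identity = λ x _ f → ·-congˡ f (·-id x)
    ; homomorphism = λ {_} {_} {_} {f} {g} x _ h → ·-congˡ h (sym (·-∘ x f g))
    ; F-resp-≈ = λ p x _ f → ·-congˡ f (·-congʳ x p) }
    where open Elements C A renaming (_≈_ to _≈ᴬ_)

  separate-local : ∀ A → IsLocal false (separate A)
  separate-local A = record
    { separated = λ {_} {x} {y} p w f →
        trans (sym (·-id _)) (trans (p w f w id⇒) (·-id _))
    ; complete = λ () }
    where open Elements C A

  -- An element glued in `B` restricts into `S` along every map from `W`, so closedness places it in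
  -- `S`.
  subpresheaf-local : ∀ {c B} (S : Subpresheaf B) → let open Elements C B in
    (∀ {k} {b : El B k} → (∀ {m} → W m → (f : m ⇒ k) → mem S m (b · f)) → mem S k b) →
    IsLocal c B → IsLocal c ⌊ S ⌋
  subpresheaf-local {B = B} S closed lB = record
    { separated = lB.separated
    ; complete = λ tc s →
        let b , p = lB.complete tc (Family-map (inclusion S) s)
        in (b , closed λ w f → respects S (B.sym (p w f)) (proj₂ (at s w f))) , p }
    where
    module B = Elements C B
    module lB = IsLocal lB

  record Reflection (c : Bool) (A : Presheaf C) : Set₁ where
    field
      reflected : Presheaf C
      local     : IsLocal c reflected
      unit      : A P.⇒ reflected
      extend    : ∀ {B} → IsLocal c B → (h : A P.⇒ B) →
                  ∃! P._≈_ λ (g : reflected P.⇒ B) → g P.∘ unit P.≈ h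

  -- One application of `families` sheafifies even a non-separated `A`: it leaves the values at
  -- objects of `W` unchanged, and these determine a sheaf.
  reflection : ∀ c A → Reflection c A
  reflection false A = record
    { reflected = separate A
    ; local = separate-local A
    ; unit = record
        { η = λ _ → record { to = id ; cong = λ p _ f → A.·-congˡ f p }
        ; commute = λ _ _ _ _ → A.refl }
    ; extend = λ {B} lB h →
        let module B = Elements C B
            module h = Morphism C h
        in record
          { η = λ k → record
              { to = λ x → h.$ x
              ; cong = λ {x} {y} p → IsLocal.separated lB λ w f →
                  B.trans (B.sym (h.$-· x f)) (B.trans (h.$-cong (p w f)) (h.$-· y f)) }
          ; commute = λ f x → h.$-· x f }
        , (λ _ _ → B.refl)
        , λ q k x → B.sym (q k x) }
    where module A = Elements C A
  reflection true A = record
    { reflected = families A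
    ; local = families-local A
    ; unit = restrictions A
    ; extend = λ {B} lB h →
        let module A = Elements C A
            module B = Elements C B
            module h = Morphism C h
            module lB = IsLocal lB
            glue : ∀ {k} → Family A k → El B k
            glue s = proj₁ (lB.complete tt (Family-map h s))
            glue-· : ∀ {k} (s : Family A k) {m} (w : W m) (f : m ⇒ k) →
                     glue s B.· f B.≈ h.$ at s w f
            glue-· s = proj₂ (lB.complete tt (Family-map h s))
        in record
          { η = λ k → record
              { to = glue
              ; cong = λ {s} {t} p → lB.separated λ w f →
                  B.trans (glue-· s w f) (B.trans (h.$-cong (p w f)) (B.sym (glue-· t w f))) }
          ; commute = λ g s → lB.separated λ w f →
              B.trans (glue-· _ w f) (B.trans (B.sym (glue-· s w (g ∘ f))) (B.sym (B.·-∘ _ g f))) }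
        , (λ k x → lB.separated λ w f → B.trans (glue-· _ w f) (h.$-· x f))
        -- Restricted along `f` from `W`, the family `s` becomes the image of `at s w f` under the
        -- unit, where `q` prescribes `g`.
        , λ {g} q k s →
            let module g = Morphism C g
            in lB.separated λ {m} w f → B.trans (glue-· s w f)
              (B.trans (B.sym (q m (at s w f)))
              (B.trans (g.$-cong {x = Morphism.$_ C (restrictions A) (at s w f)} {s at∙ f}
                  λ v e → at-· s w v f e)
                (g.$-· s f))) }
    where
    _at∙_ : ∀ {k l} → Family A k → l ⇒ k → Family A l
    _at∙_ = Elements._·_ C (families A)

-- The quasitopos structure on local objects.

module LocalQuasitopos
  (C : Category 0ℓ 0ℓ 0ℓ) (W : Pred (Category.Ob C) 0ℓ) (c : Bool)
  -- To be instantiated by `Separated` or `Sheaf`, with `c` telling which; `to` and `from` trade it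
  -- for the elementwise condition.
  (P : Pred (Presheaf C) (lsuc 0ℓ))
  (to : ∀ {A} → P A → Local.IsLocal C W c A)
  (from : ∀ {A} → Local.IsLocal C W c A → P A) where

  open Category C
  open Local C W
  open Family
  private
    E = FullSubcategory (Presheaves C) P
    module E = Category E
    module Obj (A : E.Ob) where
      open Elements C (proj₁ A) public
      open IsLocal (to (proj₂ A)) public

  -- The limit of presheaves is already local: gluing is done in each component, and compatibility
  -- along an arrow `u`, valid after restriction from `W`, follows by separatedness.
  limit : {J : Category 0ℓ 0ℓ 0ℓ} (D : Functor J E) → Limit D
  limit {J} D = record
    { cone = record
        { apex = apex , from apex-local
        ; leg = leg
        ; commute = λ u _ x → proj₂ x u }
    ; universal = λ K →
        let module K = Cone K
            module leg X = Morphism C (K.leg X)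
        in record
          { η = λ k → record
              { to = λ x → (λ X → leg.$_ X x) , λ u → K.commute u k x
              ; cong = λ p X → leg.$-cong X p }
          ; commute = λ f x X → leg.$-· X x f }
        , (λ X k x → D.refl X)
        , λ q k x X → D.sym X (q X k x) }
    where
    module J = Category J
    open Functor D
    module D X = Obj (F₀ X)
    module D₁ {X} {Y} (u : X J.⇒ Y) = Morphism C {proj₁ (F₀ X)} {proj₁ (F₀ Y)} (F₁ u)
    apex : Presheaf C
    apex = record
      { F₀ = λ k → record
          { Carrier = Σ[ x ∈ (∀ X → El (proj₁ (F₀ X)) k) ]
                      (∀ {X Y} (u : X J.⇒ Y) → D._≈_ Y (D₁.$_ u (x X)) (x Y))
          ; _≈_ = λ x y → ∀ X → D._≈_ X (proj₁ x X) (proj₁ y X)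
          ; isEquivalence = record
              { refl = λ X → D.refl X
              ; sym = λ p X → D.sym X (p X)
              ; trans = λ p q X → D.trans X (p X) (q X) } }
      ; F₁ = λ f → record
          { to = λ (x , p) → (λ X → D._·_ X (x X) f) ,
              λ {X} {Y} u → D.trans Y (D₁.$-· u (x X) f) (D.·-congˡ Y f (p u))
          ; cong = λ p X → D.·-congˡ X f (p X) }
      ; identity = λ (x , _) X → D.·-id X (x X)
      ; homomorphism = λ {_} {_} {_} {f} {g} (x , _) X → D.sym X (D.·-∘ X (x X) f g)
      ; F-resp-≈ = λ p (x , _) X → D.·-congʳ X (x X) p }
    leg : ∀ X → Category._⇒_ (Presheaves C) apex (proj₁ (F₀ X))
    leg X = record
      { η = λ k → record { to = λ x → proj₁ x X ; cong = λ p → p X }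
      ; commute = λ _ _ → D.refl X }
    apex-local : IsLocal c apex
    apex-local = record
      { separated = λ p X → D.separated X λ w f → p w f X
      ; complete = λ tc s →
          let glue X = D.complete X tc (Family-map (leg X) s)
          in ((λ X → proj₁ (glue X))
             , λ {X} {Y} u → D.separated Y λ w f → D.trans Y (D.sym Y (D₁.$-· u _ f))
                 (D.trans Y (D₁.$-cong u (proj₂ (glue X) w f))
                 (D.trans Y (proj₂ (at s w f) u) (D.sym Y (proj₂ (glue Y) w f)))))
             , λ w f X → proj₂ (glue X) w f }

  -- The colimit of presheaves, formed by closing `_~_` to an equivalence, is followed by the
  -- reflection. A cocone appears here as a `Cone` over `opF D`.
  colimit : {J : Category 0ℓ 0ℓ 0ℓ} (D : Functor J E) → Colimit D
  colimit {J} D = record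
    { cone = record
        { apex = R.reflected , from R.local
        ; leg = λ X → R.unit P.∘ injection X
        ; commute = λ {X} {Y} u k x →
            R.$-cong (Closure.symmetric _~_ (Closure.return (u , D.refl X))) }
    ; universal = λ K →
        let module K = Cone K
            h , p , h-unique = R.extend (to (proj₂ K.apex)) (descend K)
        in h
         , (λ X k x → p k (X , x))
         , λ {h′} q → h-unique {h′} λ k (X , x) → q X k x }
    where
    module J = Category J
    module P = Category (Presheaves C)
    open Functor D
    module D X = Obj (F₀ X)
    module D₁ {X} {Y} (u : X J.⇒ Y) = Morphism C {proj₁ (F₀ X)} {proj₁ (F₀ Y)} (F₁ u)
    Point : Ob → Set
    Point k = Σ[ X ∈ J.Ob ] El (proj₁ (F₀ X)) k
    _~_ : ∀ {k} → Point k → Point k → Set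
    (X , x) ~ (Y , y) = Σ[ u ∈ X J.⇒ Y ] D._≈_ Y (D₁.$_ u x) y
    ≈⇒~ : ∀ {k X} {x y : El (proj₁ (F₀ X)) k} → D._≈_ X x y → (X , x) ~ (X , y)
    ≈⇒~ {k} {X} {x} p = J.id⇒ , D.trans X (identity k x) p
    colim : Presheaf C
    colim = record
      { F₀ = λ k → Closure.setoid (_~_ {k})
      ; F₁ = λ f → record
          { to = λ (X , x) → X , D._·_ X x f
          ; cong = Closure.gmap _ λ {(X , x)} {(Y , y)} (u , p) →
              u , D.trans Y (D₁.$-· u x f) (D.·-congˡ Y f p) }
      ; identity = λ (X , x) → Closure.return (≈⇒~ (D.·-id X x))
      ; homomorphism = λ {_} {_} {_} {f} {g} (X , x) →
          Closure.return (≈⇒~ (D.sym X (D.·-∘ X x f g)))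
      ; F-resp-≈ = λ p (X , x) → Closure.return (≈⇒~ (D.·-congʳ X x p)) }
    injection : ∀ X → proj₁ (F₀ X) P.⇒ colim
    injection X = record
      { η = λ k → record { to = X ,_ ; cong = λ p → Closure.return (≈⇒~ p) }
      ; commute = λ _ _ → Closure.reflexive _~_ }
    module R where
      open Reflection (reflection c colim) public
      open Morphism C unit public
    descend : (K : Cone (opF D)) → colim P.⇒ proj₁ (Cone.apex K)
    descend K = record
      { η = λ k → record
          { to = λ (X , x) → leg.$_ X x
          ; cong = Closure.gfold (Setoid.isEquivalence (Functor.F₀ (proj₁ K.apex) k)) _
              λ {(X , x)} {(Y , y)} (u , p) →
                A.trans (A.sym (K.commute u k x)) (leg.$-cong Y p) }
      ; commute = λ f (X , x) → leg.$-· X x f }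
      where
      module K = Cone K
      module A = Obj K.apex
      module leg X = Morphism C (K.leg X)

  -- Slices: pullbacks and exponentials.

  module _ (A : E.Ob) where
    private
      module S = Category (Slice E A)
      module A = Obj A

    module Pullback (X Y : S.Ob) where
      private
        module X = Obj (proj₁ X)
        module Y = Obj (proj₁ Y)
        module p = Morphism C (proj₂ X)
        module q = Morphism C (proj₂ Y)

      pullback : Presheaf C
      pullback = record
        { F₀ = λ k → record
            { Carrier = Σ[ (x , y) ∈ El (proj₁ (proj₁ X)) k × El (proj₁ (proj₁ Y)) k ]
                        p.$ x A.≈ q.$ y
            ; _≈_ = λ ((x , y) , _) ((x′ , y′) , _) → x X.≈ x′ × y Y.≈ y′
            ; isEquivalence = record
                { refl = X.refl , Y.refl
                ; sym = λ (e , d) → X.sym e , Y.sym d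
                ; trans = λ (e , d) (e′ , d′) → X.trans e e′ , Y.trans d d′ } }
        ; F₁ = λ f → record
            { to = λ ((x , y) , e) → (x X.· f , y Y.· f) ,
                A.trans (p.$-· x f) (A.trans (A.·-congˡ f e) (A.sym (q.$-· y f)))
            ; cong = λ (e , d) → X.·-congˡ f e , Y.·-congˡ f d }
        ; identity = λ ((x , y) , _) → X.·-id x , Y.·-id y
        ; homomorphism = λ {_} {_} {_} {f} {g} ((x , y) , _) →
            X.sym (X.·-∘ x f g) , Y.sym (Y.·-∘ y f g)
        ; F-resp-≈ = λ e ((x , y) , _) → X.·-congʳ x e , Y.·-congʳ y e }

      fst : Category._⇒_ (Presheaves C) pullback (proj₁ (proj₁ X))
      fst = record
        { η = λ _ → record { to = λ z → proj₁ (proj₁ z) ; cong = proj₁ }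
        ; commute = λ _ _ → X.refl }

      snd : Category._⇒_ (Presheaves C) pullback (proj₁ (proj₁ Y))
      snd = record
        { η = λ _ → record { to = λ z → proj₂ (proj₁ z) ; cong = proj₂ }
        ; commute = λ _ _ → Y.refl }

      pullback-local : IsLocal c pullback
      pullback-local = record
        { separated = λ h →
            X.separated (λ w f → proj₁ (h w f)) , Y.separated (λ w f → proj₂ (h w f))
        ; complete = λ tc s →
            let x , ex = X.complete tc (Family-map fst s)
                y , ey = Y.complete tc (Family-map snd s)
            in ((x , y) , A.separated λ w f →
                 A.trans (A.sym (p.$-· x f)) (A.trans (p.$-cong (ex w f))
                 (A.trans (proj₂ (at s w f)) (A.trans (q.$-cong (Y.sym (ey w f))) (q.$-· y f)))))
             , λ w f → ex w f , ey w f }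

      product : Product (Slice E A) X Y
      product = record
        { obj = (pullback , from pullback-local) , Category._∘_ (Presheaves C) (proj₂ X) fst
        ; π₁ = fst , λ _ _ → A.refl
        ; π₂ = snd , λ _ z → A.sym (proj₂ z)
        ; ⟨_,_⟩ = λ (f , e) (g , d) →
            let module f = Morphism C f
                module g = Morphism C g
            in record
              { η = λ k → record
                  { to = λ z → (f.$ z , g.$ z) , A.trans (e k z) (A.sym (d k z))
                  ; cong = λ r → f.$-cong r , g.$-cong r }
              ; commute = λ h z → f.$-· z h , g.$-· z h }
            , e
        ; project₁ = λ _ _ → X.refl
        ; project₂ = λ _ _ → Y.refl
        ; unique = λ e d k z → X.sym (e k z) , Y.sym (d k z) }

    module SliceExponential (X Y : S.Ob) where
      private
        module X = Obj (proj₁ X)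
        module Y = Obj (proj₁ Y)
        module p = Morphism C (proj₂ X)
        module q = Morphism C (proj₂ Y)

      -- A point a of A and a map to Y, over A, from the pullback of X along a : y(k) → A.
      record Section (k : Ob) : Set where
        field
          base    : El (proj₁ A) k
          app     : ∀ {l} (f : l ⇒ k) (x : El (proj₁ (proj₁ X)) l) → p.$ x A.≈ base A.· f →
                    El (proj₁ (proj₁ Y)) l
          over    : ∀ {l} (f : l ⇒ k) x e → q.$ app {l} f x e A.≈ base A.· f
          app-cong : ∀ {l} {f g : l ⇒ k} {x x′} e e′ → f ≈ g → x X.≈ x′ → app f x e Y.≈ app g x′ e′
          app-·   : ∀ {l m} (f : l ⇒ k) x e (g : m ⇒ l) e′ →
                    app f x e Y.· g Y.≈ app (f ∘ g) (x X.· g) e′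

      open Section

      ·-over : ∀ {k l m} {a : El (proj₁ A) k} {x : El (proj₁ (proj₁ X)) l} {f : l ⇒ k} (g : m ⇒ l) →
               p.$ x A.≈ a A.· f → p.$ (x X.· g) A.≈ a A.· (f ∘ g)
      ·-over {a = a} {x} {f} g e = A.trans (p.$-· x g) (A.trans (A.·-congˡ g e) (A.·-∘ a f g))

      sections : Presheaf C
      sections = record
        { F₀ = λ k → record
            { Carrier = Section k
            ; _≈_ = λ s t → base s A.≈ base t ×
                (∀ {l} (f : l ⇒ k) x e e′ → app s f x e Y.≈ app t f x e′)
            ; isEquivalence = record
                { refl = λ {s} → A.refl , λ f x e e′ → app-cong s e e′ Equiv.refl X.refl
                ; sym = λ (r , h) → A.sym r , λ f x e e′ → Y.sym (h f x e′ e)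
                ; trans = λ (r , h) (r′ , h′) → A.trans r r′ , λ f x e e′ →
                    let e″ = A.trans e (A.·-congˡ f r)
                    in Y.trans (h f x e e″) (h′ f x e″ e′) } }
        ; F₁ = λ {k} {l} h → record
            { to = λ s → record
                { base = base s A.· h
                ; app = λ f x e → app s (h ∘ f) x (A.trans e (A.·-∘ _ h f))
                ; over = λ f x e → A.trans (over s (h ∘ f) x _) (A.sym (A.·-∘ _ h f))
                ; app-cong = λ e e′ r → app-cong s _ _ (∘-resp-≈ Equiv.refl r)
                ; app-· = λ f x e g e′ → Y.trans
                    (app-· s (h ∘ f) x _ g (·-over g (A.trans e (A.·-∘ _ h f))))
                    (app-cong s _ _ assoc X.refl) }
            ; cong = λ (r , d) → A.·-congˡ h r , λ f x e e′ → d (h ∘ f) x _ _ }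
        ; identity = λ s → A.·-id _ , λ f x e e′ → app-cong s _ _ identityˡ X.refl
        ; homomorphism = λ {_} {_} {_} {f} {g} s →
            A.sym (A.·-∘ _ f g) , λ h x e e′ → app-cong s _ _ assoc X.refl
        ; F-resp-≈ = λ r s →
            A.·-congʳ _ r , λ h x e e′ → app-cong s _ _ (∘-resp-≈ r Equiv.refl) X.refl }

      private
        module sections = Elements C sections

      projection : Category._⇒_ (Presheaves C) sections (proj₁ A)
      projection = record
        { η = λ k → record { to = base ; cong = proj₁ }
        ; commute = λ _ _ → A.refl }

      -- Evaluation of the exponential. Every value of a section is a `here` of one of its
      -- restrictions (`app≈here`), so sections are compared through `here`.
      here : ∀ {k} (s : Section k) x → p.$ x A.≈ base s → El (proj₁ (proj₁ Y)) k
      here s x e = app s id⇒ x (A.trans e (A.sym (A.·-id _)))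

      here-cong : ∀ {k} (s t : Section k) {x y} e e′ → s sections.≈ t → x X.≈ y →
                  here s x e Y.≈ here t y e′
      here-cong s t e e′ (r , h) d = Y.trans (h id⇒ _ _ e″) (app-cong t e″ _ Equiv.refl d)
        where e″ = A.trans (p.$-cong d) (A.trans e′ (A.sym (A.·-id _)))

      here-· : ∀ {k l} (s : Section k) x e (f : l ⇒ k) e′ →
               here s x e Y.· f Y.≈ here (s sections.· f) (x X.· f) e′
      here-· s x e f e′ = Y.trans
        (app-· s id⇒ x _ f (A.trans e′ (A.·-congʳ _ (Equiv.sym identityˡ))))
        (app-cong s _ _ (Equiv.trans identityˡ (Equiv.sym identityʳ)) X.refl)

      app≈here : ∀ {k l} (s : Section k) (f : l ⇒ k) x e → app s f x e Y.≈ here (s sections.· f) x e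
      app≈here s f x e = app-cong s _ _ (Equiv.sym identityʳ) X.refl

      app-·≈here : ∀ {k l m} (s : Section k) (f : l ⇒ k) x e (g : m ⇒ l) e′ →
                   app s f x e Y.· g Y.≈ here (s sections.· (f ∘ g)) (x X.· g) e′
      app-·≈here s f x e g e′ = Y.trans (app-· s f x e g e′) (app≈here s (f ∘ g) _ e′)

      -- After restriction along `g` from `W`, the value of `s` at `f` is a `here` of `s` restricted
      -- along `f ∘ g`, again a map from `W`, where `s` and `t` agree. Separatedness of `Y`
      -- concludes.
      sections-separated : IsSeparated sections
      sections-separated {k} {s} {t} h =
        A.separated (λ w f → proj₁ (h w f)) , λ f x e e′ → Y.separated λ w g →
          Y.trans (app-·≈here s f x e g (·-over g e))
          (Y.trans (here-cong (s sections.· (f ∘ g)) (t sections.· (f ∘ g))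
                     (·-over g e) (·-over g e′) (h w (f ∘ g)) X.refl)
          (Y.sym (app-·≈here t f x e′ g (·-over g e′))))

      -- The bases glue in `A`. The value at a point `x` of `X` over the glued base is glued in `Y`
      -- from the values of the given sections at the restrictions of `x` along maps from `W`.
      sections-complete : T c → IsComplete sections
      sections-complete tc {k} s = glued , λ w f →
        -- Equality of sections concerns all `h` and `x`; separatedness of `Y` reduces it to
        -- restrictions along `g` from `W`, where both sides are a `here`.
        a-· w f , λ h x e e′ → Y.separated λ v g →
          let d = A.trans e (A.·-∘ a f h) in
          Y.trans (value-· d v g (matches d v g))
          (Y.trans (here-cong (at s v ((f ∘ h) ∘ g)) (at s w f sections.· (h ∘ g))
              (matches d v g) (·-over g e′)
              (sections.trans
                {x = at s v ((f ∘ h) ∘ g)} {at s v (f ∘ (h ∘ g))} {at s w f sections.· (h ∘ g)}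
                (at-cong s v v assoc)
                (sections.sym {x = at s w f sections.· (h ∘ g)} {at s v (f ∘ (h ∘ g))}
                  (at-· s w v f (h ∘ g))))
              X.refl)
          (Y.sym (app-·≈here (at s w f) h x e′ g (·-over g e′))))
        where
        base-glued = A.complete tc (Family-map projection s)
        a : El (proj₁ A) k
        a = proj₁ base-glued
        a-· : ∀ {m} (w : W m) f → a A.· f A.≈ base (at s w f)
        a-· = proj₂ base-glued
        matches : ∀ {l} {h : l ⇒ k} {x} (e : p.$ x A.≈ a A.· h) {m} (w : W m) (g : m ⇒ l) →
                  p.$ (x X.· g) A.≈ base (at s w (h ∘ g))
        matches e w g = A.trans (·-over g e) (a-· w _)
        values : ∀ {l} {h : l ⇒ k} {x} (e : p.$ x A.≈ a A.· h) → Family (proj₁ (proj₁ Y)) l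
        values {h = h} {x} e = record
          { at = λ w g → here (at s w (h ∘ g)) (x X.· g) (matches e w g)
          ; at-cong = λ v w r → here-cong (at s v _) (at s w _) (matches e v _) (matches e w _)
              (at-cong s v w (∘-resp-≈ Equiv.refl r)) (X.·-congʳ x r)
          ; at-· = λ v w g g′ →
              let m = ·-over′ g′ (matches e v g)
              in Y.trans (here-· (at s v (h ∘ g)) _ (matches e v g) g′ m)
              (here-cong (at s v (h ∘ g) sections.· g′) (at s w (h ∘ (g ∘ g′)))
                m (matches e w (g ∘ g′))
                (sections.trans
                  {x = at s v (h ∘ g) sections.· g′} {at s w ((h ∘ g) ∘ g′)} {at s w (h ∘ (g ∘ g′))}
                  (at-· s v w (h ∘ g) g′) (at-cong s w w assoc))
                (X.·-∘ x g g′)) }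
          where
          ·-over′ : ∀ {l m} {b : El (proj₁ A) l} {x} (g : m ⇒ l) →
                    p.$ x A.≈ b → p.$ (x X.· g) A.≈ b A.· g
          ·-over′ g r = A.trans (p.$-· _ g) (A.·-congˡ g r)
        value : ∀ {l} {h : l ⇒ k} {x} → p.$ x A.≈ a A.· h → El (proj₁ (proj₁ Y)) l
        value e = proj₁ (Y.complete tc (values e))
        value-· : ∀ {l} {h : l ⇒ k} {x} (e : p.$ x A.≈ a A.· h) {m} (w : W m) (g : m ⇒ l) e′ →
                  value e Y.· g Y.≈ here (at s w (h ∘ g)) (x X.· g) e′
        value-· e w g e′ = Y.trans (proj₂ (Y.complete tc (values e)) w g)
          (here-cong (at s w _) (at s w _) (matches e w g) e′ (sections.refl {x = at s w _}) X.refl)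
        glued : Section k
        glued = record
          { base = a
          ; app = λ f x e → value e
          ; over = λ f x e → A.separated λ w g →
              A.trans (A.sym (q.$-· _ g)) (A.trans (q.$-cong (value-· e w g (matches e w g)))
              (A.trans (over (at s w (f ∘ g)) id⇒ _ _)
              (A.trans (A.·-id _) (A.trans (A.sym (a-· w (f ∘ g))) (A.sym (A.·-∘ a f g))))))
          ; app-cong = λ {_} {f} {f′} e e′ r d → Y.separated λ w g →
              Y.trans (value-· e w g (matches e w g))
              (Y.trans (here-cong (at s w _) (at s w _) (matches e w g) (matches e′ w g)
                (at-cong s w w (∘-resp-≈ r Equiv.refl)) (X.·-congˡ g d))
              (Y.sym (value-· e′ w g (matches e′ w g))))
          ; app-· = λ f x e g e′ → Y.separated λ w g′ →
              Y.trans (Y.·-∘ _ g g′)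
              (Y.trans (value-· e w (g ∘ g′) (matches e w (g ∘ g′)))
              (Y.trans (here-cong (at s w _) (at s w _) (matches e w (g ∘ g′)) (matches e′ w g′)
                  (at-cong s w w (Equiv.sym assoc)) (X.sym (X.·-∘ x g g′)))
              (Y.sym (value-· e′ w g′ (matches e′ w g′))))) }

      sections-local : IsLocal c sections
      sections-local = record
        { separated = λ {k} {s} {t} → sections-separated {k} {s} {t}
        ; complete = sections-complete }

      exponent : S.Ob
      exponent = (sections , from sections-local) , projection

      evaluate : Product.obj (Pullback.product exponent X) S.⇒ Y
      evaluate = record
        { η = λ k → record
            { to = λ ((s , x) , e) → here s x (A.sym e)
            ; cong = λ {((s , _) , e)} {((s′ , _) , e′)} (r , d) →
                here-cong s s′ (A.sym e) (A.sym e′) r d }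
        ; commute = λ f ((s , x) , e) → Y.sym (here-· s x (A.sym e) f _) }
        , λ k ((s , x) , e) → A.trans (over s id⇒ x _) (A.·-id _)

      Z×X : S.Ob → S.Ob
      Z×X Z = Product.obj (Pullback.product Z X)

      uncurry : ∀ {Z : S.Ob} → Z S.⇒ exponent → Z×X Z S.⇒ Y
      uncurry {Z} h = S._∘_ {Z×X Z} {Z×X exponent} {Y} evaluate
        (Product.⟨_,_⟩ (Pullback.product exponent X) {Z×X Z}
          (S._∘_ {Z×X Z} {Z} {exponent} h (Product.π₁ (Pullback.product Z X)))
          (Product.π₂ (Pullback.product Z X)))

      curry : ∀ {Z : S.Ob} (g : Z×X Z S.⇒ Y) →
              ∃! (S._≈_ {Z} {exponent}) λ (h : Z S.⇒ exponent) → S._≈_ {Z×X Z} {Y} (uncurry {Z} h) g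
      curry {Z} (g , g-over) = (h , λ _ _ → A.refl) , (λ k z → g.$-cong (Z.·-id _ , X.refl)) ,
          λ {h′} → h-unique {h′}
        where
        module Z = Obj (proj₁ Z)
        module r = Morphism C (proj₂ Z)
        module g = Morphism C g
        pair : ∀ {k l} {z : El (proj₁ (proj₁ Z)) k} {f : l ⇒ k} {x} → p.$ x A.≈ r.$ z A.· f →
               El (Pullback.pullback Z X) l
        pair {z = z} {f} {x} e = (z Z.· f , x) , A.trans (r.$-· z f) (A.sym e)
        h : Category._⇒_ (Presheaves C) (proj₁ (proj₁ Z)) sections
        h = record
          { η = λ k → record
              { to = λ z → record
                  { base = r.$ z
                  ; app = λ f x e → g.$ pair e
                  ; over = λ f x e → A.trans (g-over _ (pair e)) (r.$-· z f)
                  ; app-cong = λ e e′ d d′ → g.$-cong {x = pair e} {pair e′} (Z.·-congʳ z d , d′)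
                  ; app-· = λ f x e f′ e′ → Y.trans (Y.sym (g.$-· (pair e) f′))
                      (g.$-cong {y = pair e′} (Z.·-∘ z f f′ , X.refl)) }
              ; cong = λ d → r.$-cong d , λ f x e e′ →
                  g.$-cong {x = pair e} {pair e′} (Z.·-congˡ f d , X.refl) }
          ; commute = λ f z → r.$-· z f , λ f′ x e e′ →
              g.$-cong {x = pair e} {pair _} (Z.·-∘ z f f′ , X.refl) }
        h-unique : ∀ {h′ : Z S.⇒ exponent} → S._≈_ {Z×X Z} {Y} (uncurry {Z} h′) (g , g-over) →
                   S._≈_ {Z} {exponent} (h , λ _ _ → A.refl) h′
        -- By naturality the value of `h′` of `z` at `f` and `x` is the evaluation of `h′` of
        -- `z · f` at `x`, which `e` prescribes.
        h-unique {h′ , h′-over} e k z = A.sym (h′-over k z) , λ f x d d′ →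
          let module h′ = Morphism C h′
          in Y.trans (Y.sym (e _ (pair d)))
             (Y.trans (here-cong (h′.$ (z Z.· f)) (h′.$ z sections.· f) _ d′ (h′.$-· z f) X.refl)
             (Y.sym (app≈here (h′.$ z) f x d′)))

    slice-closed : CartesianClosed (Slice E A)
    slice-closed = record
      { terminal = Slice-terminal E A
      ; products = Pullback.product
      ; exponentials = λ X Y → let open SliceExponential X Y in
          exponential (Slice E A) Pullback.product {X} {Y} exponent evaluate λ {Z} → curry {Z} }

  -- The strong-subobject classifier.

  module _ (lem : ∀ {ℓ} → ExcludedMiddle ℓ) where

    -- Sieves of morphisms from W. Being Bool-valued, they form a set in Set₀, as the
    -- elements of a presheaf must.
    record Sieve (k : Ob) : Set where
      field
        holds    : ∀ {m} → W m → m ⇒ k → Bool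
        resp     : ∀ {m} (v w : W m) {f g : m ⇒ k} → f ≈ g → T (holds v f) → T (holds w g)
        restrict : ∀ {l m} (v : W l) (w : W m) (f : l ⇒ k) (g : m ⇒ l) →
                   T (holds v f) → T (holds w (f ∘ g))

    open Sieve

    sieves : Presheaf C
    sieves = record
      { F₀ = λ k → record
          { Carrier = Sieve k
          ; _≈_ = λ S R → ∀ {m} (w : W m) f →
              (T (holds S w f) → T (holds R w f)) × (T (holds R w f) → T (holds S w f))
          ; isEquivalence = record
              { refl = λ _ _ → id , id
              ; sym = λ p w f → swap (p w f)
              ; trans = λ p q w f → (λ t → proj₁ (q w f) (proj₁ (p w f) t))
                                  , (λ t → proj₂ (p w f) (proj₂ (q w f) t)) } }
      ; F₁ = λ h → record
          { to = λ S → record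
              { holds = λ w f → holds S w (h ∘ f)
              ; resp = λ v w p → resp S v w (∘-resp-≈ Equiv.refl p)
              ; restrict = λ v w f g t → resp S w w assoc (restrict S v w (h ∘ f) g t) }
          ; cong = λ p w f → p w (h ∘ f) }
      ; identity = λ S w f → resp S w w identityˡ , resp S w w (Equiv.sym identityˡ)
      ; homomorphism = λ S w f → resp S w w assoc , resp S w w (Equiv.sym assoc)
      ; F-resp-≈ = λ p S w f →
          resp S w w (∘-resp-≈ p Equiv.refl) , resp S w w (∘-resp-≈ (Equiv.sym p) Equiv.refl) }

    -- A morphism `f` lies in a sieve iff the identity lies in the restriction along `f`. Hence
    -- restrictions from `W` separate sieves, and a family is glued by asking each member whether it
    -- contains the identity.
    sieves-local : IsLocal c sieves
    sieves-local = record
      { separated = λ {_} {S} {R} p w f →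
          (λ t → resp R w w identityʳ (proj₁ (p w f w id⇒) (resp S w w (Equiv.sym identityʳ) t)))
        , (λ t → resp S w w identityʳ (proj₂ (p w f w id⇒) (resp R w w (Equiv.sym identityʳ) t)))
      ; complete = λ _ s →
          let at-∘ : ∀ {l m} (v : W l) (w : W m) f g →
                     (T (holds (at s v f) w g) → T (holds (at s w (f ∘ g)) w id⇒)) ×
                     (T (holds (at s w (f ∘ g)) w id⇒) → T (holds (at s v f) w g))
              at-∘ v w f g =
                (λ t → proj₁ (at-· s v w f g w id⇒) (resp (at s v f) w w (Equiv.sym identityʳ) t))
                , (λ t → resp (at s v f) w w identityʳ (proj₂ (at-· s v w f g w id⇒) t))
          in record
            { holds = λ w f → holds (at s w f) w id⇒
            ; resp = λ v w p t → proj₁ (at-cong s v w p w id⇒) (resp (at s v _) v w Equiv.refl t)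
            ; restrict = λ v w f g t → proj₁ (at-∘ v w f g)
                (resp (at s v f) w w identityˡ (restrict (at s v f) v w id⇒ g t)) }
          , λ w f v g → swap (at-∘ w v f g) }

    private
      module sieves = Elements C sieves

    terminal : Terminal E
    terminal = record
      { obj = record
          { F₀ = λ _ → record
              { Carrier = Unit ; _≈_ = λ _ _ → Unit
              ; isEquivalence = record { refl = tt ; sym = λ _ → tt ; trans = λ _ _ → tt } }
          ; F₁ = λ _ → record { to = id ; cong = id }
          ; identity = λ _ → tt ; homomorphism = λ _ → tt ; F-resp-≈ = λ _ _ → tt }
        , from (record { separated = λ _ → tt ; complete = λ _ _ → tt , λ _ _ → tt })
      ; ! = record { η = λ _ → record { to = λ _ → tt ; cong = λ _ → tt } ; commute = λ _ _ → tt }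
      ; !-unique = λ _ _ _ → tt }

    open Terminal terminal using (!) renaming (obj to 𝟙)

    Ωᴱ : E.Ob
    Ωᴱ = sieves , from sieves-local

    truth : 𝟙 E.⇒ Ωᴱ
    truth = record
      { η = λ _ → record
          { to = λ _ → record
              { holds = λ _ _ → true ; resp = λ _ _ _ _ → tt ; restrict = λ _ _ _ _ _ → tt }
          ; cong = λ _ _ _ → id , id }
      ; commute = λ _ _ _ _ → id , id }

    module _ {A B : E.Ob} (m : A E.⇒ B) where
      private
        module A = Obj A
        module B = Obj B
        module m = Morphism C m

      Image : ∀ {k} → El (proj₁ B) k → Set
      Image {k} b = Σ[ a ∈ El (proj₁ A) k ] m.$ a B.≈ b

      image-closure : Subpresheaf (proj₁ B)
      image-closure = record
        { mem = λ k b → ∀ {l} → W l → (f : l ⇒ k) → Image (b B.· f)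
        ; respects = λ p i w f → let a , e = i w f in a , B.trans e (B.·-congˡ f p)
        ; restrict = λ g {b} i w f →
            let a , e = i w (g ∘ f) in a , B.trans e (B.sym (B.·-∘ b g f)) }

      -- Monos in `E` are tested against local objects only, and the kernel pair of `m` is local.
      mono⇒injective : Mono E {A} {B} m →
                       ∀ {k} {a a′ : El (proj₁ A) k} → m.$ a B.≈ m.$ a′ → a A.≈ a′
      mono⇒injective mono {a = a} {a′} e =
        mono {pullback , from pullback-local} fst snd (λ _ z → proj₂ z) _ ((a , a′) , e)
        where open Pullback B (A , m) (A , m)

      -- Lifting A against its dense, hence epic, inclusion into the closure of
      -- its image shows that the image of a strong mono is closed.
      strongMono⇒closed : StrongMono E {A} {B} m →
                          ∀ {k} {b : El (proj₁ B) k} → mem image-closure k b → Image b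
      strongMono⇒closed (_ , lift) {k} {b} i =
        let d , _ , md = lift {A} {Ā} q (λ {X} → q-epi {X}) (E.id⇒ {A}) (inclusion image-closure)
                           (λ _ _ → B.refl)
        in Morphism.$_ C d (b , i) , md k (b , i)
        where
        Ā : E.Ob
        Ā = ⌊ image-closure ⌋ , from (subpresheaf-local image-closure
          (λ {_} {b} h w f →
            let a , e = h w f w id⇒
            in a , B.trans e (B.·-id _))
          (to (proj₂ B)))
        q : A E.⇒ Ā
        q = record
          { η = λ k → record
              { to = λ a → m.$ a , λ _ f → a A.· f , m.$-· a f
              ; cong = m.$-cong }
          ; commute = λ f a → m.$-· a f }
        q-epi : Epi E {A} {Ā} q
        q-epi {X} g h gq≈hq k (b , i) = X.separated λ {l} w f →
          let a , e = i w f
          in X.trans (X.sym (g.$-· (b , i) f)) (X.trans (g.$-cong (B.sym e))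
             (X.trans (gq≈hq l a) (X.trans (h.$-cong e) (h.$-· (b , i) f))))
          where
          module X = Obj X
          module g = Morphism C g
          module h = Morphism C h

      -- An element of `B` goes to the sieve of maps from `W` that restrict it into the image of
      -- `m`. This sieve is full iff the element lies in the closure of the image, which for a
      -- strong mono is the image.
      classify : StrongMono E {A} {B} m →
                 ∃! (E._≈_ {B} {Ωᴱ}) λ (χ : B E.⇒ Ωᴱ) →
                   IsPullback E {A} {B} {𝟙} {Ωᴱ} m (! {A}) χ truth
      classify strong@(mono , _) =
        characteristic , (commutes , λ {X} → universal {X}) , λ {χ} → unique {χ}
        where
        holds-image : ∀ {k l} → El (proj₁ B) k → l ⇒ k → Bool
        holds-image b f = isYes (lem {P = Image (b B.· f)})
        Image-cong : ∀ {k} {b b′ : El (proj₁ B) k} → b B.≈ b′ → Image b → Image b′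
        Image-cong e (a , p) = a , B.trans p e
        transport : ∀ {k l k′ l′}
                    (b : El (proj₁ B) k) (f : l ⇒ k) (b′ : El (proj₁ B) k′) (f′ : l′ ⇒ k′) →
                    (Image (b B.· f) → Image (b′ B.· f′)) →
                    T (holds-image b f) → T (holds-image b′ f′)
        transport _ _ _ _ h t = fromWitness (h (toWitness t))
        characteristic : B E.⇒ Ωᴱ
        characteristic = record
          { η = λ k → record
              { to = λ b → record
                  { holds = λ _ f → holds-image b f
                  ; resp = λ _ _ {f} {g} p → transport b f b g (Image-cong (B.·-congʳ b p))
                  ; restrict = λ _ _ f g → transport b f b (f ∘ g)
                      λ (a , e) → a A.· g ,
                        B.trans (m.$-· a g) (B.trans (B.·-congˡ g e) (B.·-∘ b f g)) }
              ; cong = λ {b} {b′} p w f →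
                  transport b f b′ f (Image-cong (B.·-congˡ f p))
                , transport b′ f b f (Image-cong (B.·-congˡ f (B.sym p))) }
          ; commute = λ g b w f →
              transport (b B.· g) f b (g ∘ f) (Image-cong (B.·-∘ b g f))
            , transport b (g ∘ f) (b B.· g) f (Image-cong (B.sym (B.·-∘ b g f))) }
        commutes : E._≈_ {A} {Ωᴱ} (E._∘_ {A} {B} {Ωᴱ} characteristic m)
                                  (E._∘_ {A} {𝟙} {Ωᴱ} truth (! {A}))
        commutes k a w f = (λ _ → tt) , λ _ → fromWitness (a A.· f , m.$-· a f)
        universal : ∀ {X : E.Ob} (a : X E.⇒ B) (b : X E.⇒ 𝟙) →
                    E._≈_ {X} {Ωᴱ} (E._∘_ {X} {B} {Ωᴱ} characteristic a)
                                   (E._∘_ {X} {𝟙} {Ωᴱ} truth b) →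
                    ∃! (E._≈_ {X} {A}) λ (u : X E.⇒ A) →
                      E._≈_ {X} {B} (E._∘_ {X} {A} {B} m u) a ×
                      E._≈_ {X} {𝟙} (E._∘_ {X} {A} {𝟙} (! {A}) u) b
        universal {X} a b e =
          record
            { η = λ k → record
                { to = λ x → proj₁ (preimage x)
                ; cong = λ p → injective (B.trans (proj₂ (preimage _))
                    (B.trans (a.$-cong p) (B.sym (proj₂ (preimage _))))) }
            ; commute = λ f x → injective (B.trans (proj₂ (preimage _))
                (B.trans (a.$-· x f)
                  (B.sym (B.trans (m.$-· _ f) (B.·-congˡ f (proj₂ (preimage x))))))) }
          , ((λ k x → proj₂ (preimage x)) , λ _ _ → tt)
          , λ (p , _) k x → injective (B.trans (proj₂ (preimage x)) (B.sym (p k x)))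
          where
          module a = Morphism C a
          injective : ∀ {k} {x y : El (proj₁ A) k} → m.$ x B.≈ m.$ y → x A.≈ y
          injective = mono⇒injective (λ {X} → mono {X})
          preimage : ∀ {k} (x : El (proj₁ X) k) → Image (a.$ x)
          preimage {k} x = strongMono⇒closed strong λ w f → toWitness (proj₂ (e k x w f) tt)
        unique : ∀ {χ : B E.⇒ Ωᴱ} → IsPullback E {A} {B} {𝟙} {Ωᴱ} m (! {A}) χ truth →
                 E._≈_ {B} {Ωᴱ} characteristic χ
        unique {χ} (commutes-χ , universal-χ) k b w f =
          (λ t → let a , e = toWitness t in
            resp (χ.$ b) w w identityʳ (proj₁ (χ.$-· b f w id⇒)
              (proj₁ (χ.$-cong e w id⇒) (proj₂ (commutes-χ _ a w id⇒) tt))))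
          -- Since `f` lies in the sieve of `b`, the element `b · f` lies in `true-part`, which is
          -- closed and hence local. The pullback property of `χ` factors its inclusion through `m`,
          -- and this provides the preimage.
          , λ t → fromWitness
              (let b·f : El (proj₁ truths) _
                   b·f = b B.· f , λ v g → proj₂ (χ.$-· b f v g) (restrict (χ.$ b) w v f g t)
                   u , (mu , _) , _ = universal-χ {truths} (inclusion true-part) (! {truths})
                     (λ _ (_ , t) v g → (λ _ → tt) , λ _ → t v g)
               in Morphism.$_ C u b·f , mu _ b·f)
          where
          module χ = Morphism C χ
          true-part : Subpresheaf (proj₁ B)
          true-part = record
            { mem = λ k b → ∀ {l} (v : W l) (g : l ⇒ k) → T (holds (χ.$ b) v g)
            ; respects = λ e t v g → proj₁ (χ.$-cong e v g) (t v g)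
            ; restrict = λ g {b} t v h → proj₂ (χ.$-· b g v h) (t v (g ∘ h)) }
          truths : E.Ob
          truths = ⌊ true-part ⌋ , from (subpresheaf-local true-part
            (λ {_} {b} t v g → resp (χ.$ b) v v identityʳ (proj₁ (χ.$-· b g v id⇒) (t v g v id⇒)))
            (to (proj₂ B)))

    classifier : StrongSubobjectClassifier E
    classifier = record
      { terminal = terminal ; Ω = Ωᴱ ; truth = truth ; classify = λ {A} {B} → classify {A} {B} }

    quasitopos : Quasitopos E
    quasitopos = record
      { finiteLimits = λ _ _ → limit
      ; finiteColimits = λ _ _ → colimit
      ; cartesianClosed = Slice-closed⇒closed E terminal (slice-closed 𝟙)
      ; locallyCartesianClosed = slice-closed
      ; strongSubobjectClassifier = classifier }

-- Separatedness and completeness for a topology with covers given by `W`.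

module _ {C : Category 0ℓ 0ℓ 0ℓ} where
  open Category C

  ContainsAll : ∀ {k} → Pred Ob 0ℓ → Ω C k → Set
  ContainsAll {k} W S = ∀ m → W m → (f : m ⇒ k) → mem S m f

  id∈⇔≐⊤ : ∀ {k} (S : Ω C k) → mem S k id⇒ ⇔ (S ≐ˢ ⊤ˢ)
  id∈⇔≐⊤ {k} S = mk⇔ full (λ p → proj₂ (p k) tt)
    where
    full : mem S k id⇒ → S ≐ˢ ⊤ˢ
    full p _ = (λ _ → tt) , λ {f} _ → respects S identityˡ (restrict S f p)

-- Such topologies are rigid: each object has a least covering sieve, generated by the maps from
-- objects of `W`.
module Rigid (C : Category 0ℓ 0ℓ 0ℓ) (j : ∀ k → Ω C k → Ω C k) (W : Pred (Category.Ob C) 0ℓ)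
             (covers : ∀ {k} (S : Ω C k) → (j k S ≐ˢ ⊤ˢ) ⇔ ContainsAll W S) where
  open Category C
  open Local C W
  private
    module covers {k} (S : Ω C k) = Equivalence (covers S)

  dense⇒contains : ∀ {A : Presheaf C} (A′ : Subpresheaf A) → Dense C j A′ →
                   ∀ {m} → W m → (a : El A m) → mem A′ m a
  dense⇒contains {A} A′ d w a =
    respects A′ (Elements.·-id C A a) (covers.to (χ A′ _ a) (d _ a) _ w id⇒)

  contains⇒dense : ∀ {A : Presheaf C} (A′ : Subpresheaf A) →
                   (∀ {m} → W m → (a : El A m) → mem A′ m a) → Dense C j A′
  contains⇒dense A′ h k a = covers.from (χ A′ k a) λ _ w f → h w _

  -- The least covering sieve. Membership carries a factorization, from which `complete⇒` computes.
  W-sieve : ∀ k → Ω C k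
  W-sieve k = record
    { mem = λ l f → Σ[ m ∈ Ob ] W m × Σ[ g ∈ m ⇒ k ] Σ[ h ∈ l ⇒ m ] g ∘ h ≈ f
    ; respects = λ p (m , w , g , h , q) → m , w , g , h , Equiv.trans q p
    ; restrict = λ f (m , w , g , h , q) →
        m , w , g , h ∘ f , Equiv.trans (Equiv.sym assoc) (∘-resp-≈ q Equiv.refl) }

  W-sieve-dense : ∀ {k} → Dense C j (W-sieve k)
  W-sieve-dense = contains⇒dense (W-sieve _) λ {m} w f → m , w , f , id⇒ , identityʳ

  module _ (A : Presheaf C) where
    private module A = Elements C A

    yoneda : ∀ {k} → El A k → Category._⇒_ (Presheaves C) (y C k) A
    yoneda x = record
      { η = λ l → record { to = x A.·_ ; cong = A.·-congʳ x }
      ; commute = λ f g → A.sym (A.·-∘ x g f) }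

    -- By Yoneda, elements are maps out of `y(k)`, and agreement along all maps from `W` is
    -- agreement on the dense `W-sieve`.
    separated⇒ : Separated C j A → IsSeparated A
    separated⇒ sep {k} {x} {x′} h =
      A.trans (A.sym (A.·-id x)) (A.trans
        (sep (W-sieve k) W-sieve-dense (yoneda x P.∘ inclusion (W-sieve k)) (yoneda x) (yoneda x′)
          (λ _ _ → A.refl)
          (λ l (f , m , w , g , h′ , p) →
            A.trans (A.·-congʳ x′ (Equiv.sym p)) (A.trans (A.sym (A.·-∘ x′ g h′))
            (A.trans (A.·-congˡ h′ (A.sym (h w g)))
            (A.trans (A.·-∘ x g h′) (A.·-congʳ x p)))))
          k id⇒)
        (A.·-id x′))
      where module P = Category (Presheaves C)

    -- Restrictions along maps from `W` land in the dense `B′`, where `g` and `h` both equal `f`.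
    separated⇐ : IsSeparated A → Separated C j A
    separated⇐ sep {B} B′ d f g h gf hf k b = sep λ {m} w u →
      let b′ = b B.· u , dense⇒contains B′ d w (b B.· u)
      in A.trans (A.sym (g.$-· b u)) (A.trans (gf m b′)
         (A.trans (A.sym (hf m b′)) (h.$-· b u)))
      where
      module B = Elements C B
      module g = Morphism C g
      module h = Morphism C h

    -- A family extends to the `W-sieve` by sending `g ∘ h` to `at w g · h`; separatedness makes
    -- this independent of the factorization. The extension to `y(k)` is then evaluated at the
    -- identity.
    complete⇒ : IsSeparated A → Complete C j A → IsComplete A
    complete⇒ sep com {k} s =
      let g , p = com (W-sieve k) W-sieve-dense glued
          module g = Morphism C g
      in g.$ id⇒ , λ {m} w u →
        A.trans (A.sym (g.$-· id⇒ u)) (A.trans (g.$-cong identityˡ)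
        (A.trans (p m (u , m , w , u , id⇒ , identityʳ)) (A.·-id _)))
      where
      open Local.Family s
      at-·-· : ∀ {l m n} (v : W l) (w : W n) (g : l ⇒ k) (h : m ⇒ l) (u : n ⇒ m) →
               at v g A.· h A.· u A.≈ at w (g ∘ h ∘ u)
      at-·-· v w g h u = A.trans (A.·-∘ _ h u) (at-· v w g (h ∘ u))
      glued : Category._⇒_ (Presheaves C) ⌊ W-sieve k ⌋ A
      glued = record
        { η = λ l → record
            { to = λ (_ , m , w , g , h , p) → at w g A.· h
            ; cong = λ {(_ , m , w , g , h , p)} {(_ , m′ , w′ , g′ , h′ , p′)} e → sep λ v u →
                A.trans (at-·-· w v g h u) (A.trans
                  (at-cong v v (Equiv.trans (Equiv.sym assoc) (Equiv.trans
                    (∘-resp-≈ (Equiv.trans p (Equiv.trans e (Equiv.sym p′))) Equiv.refl) assoc)))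
                (A.sym (at-·-· w′ v g′ h′ u))) }
        ; commute = λ u (_ , m , w , g , h , p) → A.sym (A.·-∘ (at w g) h u) }

    -- Restrictions of `b` along maps from `W` lie in `B′`, so their images under `f` form a family;
    -- it glues to the value at `b`.
    complete⇐ : IsSeparated A → IsComplete A → Complete C j A
    complete⇐ sep com {B} B′ d f =
      record
        { η = λ k → record
            { to = λ b → proj₁ (com (values b))
            ; cong = λ {b} {b′} p → sep λ w u →
                A.trans (value-· b w u)
                (A.trans (f.$-cong (B.·-congˡ u p)) (A.sym (value-· b′ w u))) }
        ; commute = λ g b → sep λ w u →
            A.trans (value-· _ w u) (A.trans (f.$-cong (B.·-∘ b g u))
            (A.trans (A.sym (value-· b w (g ∘ u))) (A.sym (A.·-∘ _ g u)))) }
      , λ k b → sep λ w u → A.trans (value-· (proj₁ b) w u)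
          (A.trans (f.$-cong {y = proj₁ b B.· u , restrict B′ u (proj₂ b)} B.refl) (f.$-· b u))
      where
      module B = Elements C B
      module f = Morphism C f
      value : ∀ {m} → W m → El B m → El ⌊ B′ ⌋ m
      value w b = b , dense⇒contains B′ d w b
      values : ∀ {k} → El B k → Family A k
      values b = record
        { at = λ w u → f.$ value w (b B.· u)
        ; at-cong = λ v w p → f.$-cong (B.·-congʳ b p)
        ; at-· = λ v w u g →
            A.trans (A.sym (f.$-· (value v (b B.· u)) g)) (f.$-cong (B.·-∘ b u g)) }
      value-· : ∀ {k} (b : El B k) {m} (w : W m) (u : m ⇒ k) →
                proj₁ (com (values b)) A.· u A.≈ f.$ value w (b B.· u)
      value-· b = proj₂ (com (values b))

  quasitoposes : (∀ {ℓ} → ExcludedMiddle ℓ) → Quasitopos (Sep C j) × Quasitopos (Sh C j)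
  quasitoposes lem =
      LocalQuasitopos.quasitopos C W false (Separated C j)
        (λ {A} p → record { separated = separated⇒ A p ; complete = λ () })
        (λ {A} p → separated⇐ A (IsLocal.separated p)) lem
    , LocalQuasitopos.quasitopos C W true (Sheaf C j)
        (λ {A} (p , q) → record
          { separated = separated⇒ A p ; complete = λ _ → complete⇒ A (separated⇒ A p) q })
        (λ {A} p → let open IsLocal p in
          separated⇐ A separated , complete⇐ A separated (complete tt)) lem

-- The topologies j^w

private
  module Δ  = Category Δ
  module Δ₊ = Category Δ₊

-- Injective monotone maps and their factorization through faces.

Δ₊⇒≤ : ∀ {m k} → m Δ₊.⇒ k → m ≤ k
Δ₊⇒≤ (_ , f-injective) = s≤s⁻¹ (injective⇒≤ f-injective)

-- If no point were missed, choosing preimages would inject a larger finite set into a smaller one.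
missed-point : ∀ {m n} (f : m Δ₊.⇒ n) → m < n → ∃[ i ] (∀ t → i ≢ fun (proj₁ f) t)
missed-point {m} {n} f m<n with any? (λ i → all? (λ t → ¬? (i ≟ fun (proj₁ f) t)))
... | yes p = p
... | no ¬p = contradiction (injective⇒≤ section-injective) (<⇒≱ (s≤s m<n))
  where
  preimage : ∀ i → ∃[ t ] i ≡ fun (proj₁ f) t
  preimage i with any? (λ t → i ≟ fun (proj₁ f) t)
  ... | yes p = p
  ... | no ¬q = contradiction (i , λ t p → ¬q (t , p)) ¬p
  section-injective : Injective _≡_ _≡_ (λ i → proj₁ (preimage i))
  section-injective {i} {i′} p =
    ≡.trans (proj₂ (preimage i)) (≡.trans (cong (fun (proj₁ f)) p) (≡.sym (proj₂ (preimage i′))))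

face-factorization : ∀ {m n} (f : m Δ₊.⇒ suc n) → m ≤ n → ∃[ i ] Σ[ g ∈ m Δ₊.⇒ n ] δ i Δ₊.∘ g Δ₊.≈ f
face-factorization (f , f-injective) m≤n with missed-point (f , f-injective) (s≤s m≤n)
... | i , i≢f =
  i , (monotone (λ t → punchOut (i≢f t)) (λ p → punchOut-mono-≤ (i≢f _) (i≢f _) (mono f p))
      , λ {s} {t} p → f-injective (punchOut-injective (i≢f s) (i≢f t) p))
    , λ t → punchIn-punchOut (i≢f t)

id∉∂ : ∀ {n} → ¬ mem (∂ n) (suc n) Δ₊.id⇒
id∉∂ (i , h , p) = punchInᵢ≢i i _ (p i)

-- Definite descriptions and the covering sieves of `j₊`.

module _ (lem : ∀ {ℓ} → ExcludedMiddle ℓ) where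
  open Topologies lem

  the-satisfies : ∀ {a p} {A : Set a} (junk : A) (P : Pred A p) → ∃ P → P (the junk P)
  the-satisfies _ P w with lem {P = ∃ P}
  ... | yes (_ , p) = p
  ... | no ¬p = contradiction w ¬p

  the-satisfies-or-junk : ∀ {a p} {A : Set a} (junk : A) (P : Pred A p) →
                          P (the junk P) ⊎ the junk P ≡ junk
  the-satisfies-or-junk _ P with lem {P = ∃ P}
  ... | yes (_ , p) = inj₁ p
  ... | no _ = inj₂ ≡.refl

  -- The covering condition at stage `k`. An equation links the dimension to its index, since `m` is
  -- a free natural number while letters are indexed by `Fin`.
  ZeroFaces : ∀ {k} → Vector Bool (suc k) → Ω₊ k → Set
  ZeroFaces {k} w x = ∀ m (i : Fin (suc k)) → toℕ i ≡ m → w i ≡ false → (f : m Δ₊.⇒ k) → mem x m f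

  ≐⊤⇒ZeroFaces : ∀ {k} (w : Vector Bool (suc k)) (x : Ω₊ k) → x ≐ˢ ⊤ˢ → ZeroFaces w x
  ≐⊤⇒ZeroFaces w x p _ _ _ _ f = proj₂ (p _) tt

  false≢true : ∀ {b} → b ≡ false → b ≢ true
  false≢true ≡.refl ()

  ≐ˢ-refl : ∀ {k} {x : Ω₊ k} → x ≐ˢ x
  ≐ˢ-refl k = id , id

  ZeroFaces-face : ∀ {n} (w : Vector Bool (suc (suc n))) (x : Ω₊ (suc n)) →
                   ZeroFaces w x → ∀ i → ZeroFaces (init w) (Ω₁ (δ i) x)
  ZeroFaces-face w x h i m l l≡m q f = h m (inject₁ l) (≡.trans (toℕ-inject₁ l) l≡m) q (δ i Δ₊.∘ f)

  -- With last letter 1, only maps from dimensions at most `n` are demanded, and each factors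
  -- through a face.
  ZeroFaces-faces : ∀ {n} (w : Vector Bool (suc (suc n))) (x : Ω₊ (suc n)) →
                    w (fromℕ (suc n)) ≡ true →
                    (∀ i → ZeroFaces (init w) (Ω₁ (δ i) x)) → ZeroFaces w x
  ZeroFaces-faces w x w-top h m l l≡m q f with view l
  ... | ‵fromℕ = contradiction w-top (false≢true q)
  ... | ‵inject₁ l′ =
    let l′≡m = ≡.trans (≡.sym (toℕ-inject₁ l′)) l≡m
        i , g , δg≈f = face-factorization f (subst (_≤ _) l′≡m (s≤s⁻¹ (toℕ<n l′)))
    in respects x δg≈f (h i m l′ l′≡m q g)

  -- Both sides fail: the boundary lacks the identity, and last letter 0 would demand the identity
  -- in `x`, making `x` full.
  ∂-covers : ∀ {n} (w : Vector Bool (suc (suc n))) (x : Ω₊ (suc n)) → ¬ x ≐ˢ ⊤ˢ →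
             w (fromℕ (suc n)) ≡ false → (∂ n ≐ˢ ⊤ˢ) ⇔ ZeroFaces w x
  ∂-covers w x x≭⊤ w-top = mk⇔
    (λ ∂≐⊤ → contradiction (proj₂ (∂≐⊤ _) {Δ₊.id⇒} tt) id∉∂)
    (λ h → contradiction
      (Equivalence.to (id∈⇔≐⊤ x) (h _ (fromℕ _) (toℕ-fromℕ _) w-top Δ₊.id⇒)) x≭⊤)

  -- Either the described element exists, and its being full would make every `z i` full, or the
  -- description returns its junk value `⊥ˢ`, which is not full either.
  the-amalgam≭⊤ : ∀ {n} (z : Fin (suc (suc n)) → Ω₊ n) → ¬ (∀ i → z i ≐ˢ ⊤ˢ) →
                  ¬ the ⊥ˢ (λ u → ∀ i → Ω₁ (δ i) u ≐ˢ z i) ≐ˢ ⊤ˢ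
  the-amalgam≭⊤ z z≭⊤ u≐⊤
    with the-satisfies-or-junk ⊥ˢ (λ u → ∀ i → Ω₁ (δ i) u ≐ˢ z i)
  ... | inj₁ p = z≭⊤ λ i l → (λ _ → tt) , λ _ → proj₁ (p i l) (proj₂ (u≐⊤ l) tt)
  ... | inj₂ u≡⊥ = proj₂ (subst (_≐ˢ ⊤ˢ) u≡⊥ u≐⊤ _) {Δ₊.id⇒} tt

  j₊-covers : ∀ {k} (w : Vector Bool (suc k)) (x : Ω₊ k) → (j₊ k w x ≐ˢ ⊤ˢ) ⇔ ZeroFaces w x
  j₊-covers {zero} w x with w zero in eq
  ... | true = mk⇔ (λ { _ _ zero _ w≡false → contradiction eq (false≢true w≡false) })
                   (λ _ → ≐ˢ-refl)
  ... | false = mk⇔ (≐⊤⇒ZeroFaces w x)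
                    (λ h → Equivalence.to (id∈⇔≐⊤ x) (h _ zero ≡.refl eq Δ₊.id⇒))
  j₊-covers {suc n} w x
    -- These are the scrutinees of `j₊`, so its value reduces in each clause; `w (fromℕ (suc n))` is
    -- `last w`.
    with lem {P = x ≐ˢ ⊤ˢ} | lem {P = x ≐ˢ ∂ n}
       | lem {P = ∀ i → j₊ n (init w) (Ω₁ (δ i) x) ≐ˢ ⊤ˢ} | w (fromℕ (suc n)) in eq
  ... | yes x≐⊤ | _ | _ | _ = mk⇔ (λ _ → ≐⊤⇒ZeroFaces w x x≐⊤) (λ _ → ≐ˢ-refl)
  ... | no _ | yes x≐∂ | _ | true =
    mk⇔ (λ _ → ZeroFaces-faces w x eq λ i _ _ _ _ f → proj₂ (x≐∂ _) (i , f , λ _ → ≡.refl))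
        (λ _ → ≐ˢ-refl)
  ... | no x≭⊤ | yes _ | _ | false = ∂-covers w x x≭⊤ eq
  ... | no _ | no _ | yes z≐⊤ | true =
    mk⇔ (λ _ → ZeroFaces-faces w x eq λ i → Equivalence.to (j₊-covers (init w) (Ω₁ (δ i) x)) (z≐⊤ i))
        (λ _ → ≐ˢ-refl)
  ... | no x≭⊤ | no _ | yes _ | false = ∂-covers w x x≭⊤ eq
  -- Both sides fail: by induction, `ZeroFaces` would make every `z i` full.
  ... | no _ | no _ | no z≭⊤ | _ =
    mk⇔ (λ u≐⊤ → contradiction u≐⊤ (the-amalgam≭⊤ (λ i → j₊ _ (init w) (Ω₁ (δ i) x)) z≭⊤))
        (λ h → contradiction
          (λ i → Equivalence.from (j₊-covers (init w) (Ω₁ (δ i) x)) (ZeroFaces-face w x h i)) z≭⊤)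

  -- Transfer to Δ: degenerate maps.

  pinch-identifies : ∀ {n} (i : Fin n) → pinch i (inject₁ i) ≡ pinch i (suc i)
  pinch-identifies zero = ≡.refl
  pinch-identifies (suc i) = cong suc (pinch-identifies i)

  inject₁≢suc : ∀ {n} (i : Fin n) → inject₁ i ≢ suc i
  inject₁≢suc zero ()
  inject₁≢suc (suc i) p = inject₁≢suc i (suc-injective p)

  -- The simplicial identity making `δ (suc i)` a section of `σ i`; it recovers `g` from `g ∘ σ i`.
  pinch-punchIn : ∀ {n} (i t : Fin (suc n)) → pinch i (punchIn (suc i) t) ≡ t
  pinch-punchIn zero zero = ≡.refl
  pinch-punchIn zero (suc t) = ≡.refl
  pinch-punchIn {suc n} (suc i) zero = ≡.refl
  pinch-punchIn {suc n} (suc i) (suc t) = cong suc (pinch-punchIn i t)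

  -- `F k ⊤ˢ` is a subpresheaf of `y(k)` containing the identity, hence everything.
  face⊎degenerate : ∀ {k l} (f : l Δ.⇒ k) → face {k} ⊤ˢ l f ⊎ degen {k} ⊤ˢ l f
  face⊎degenerate {k} f = restrict (F k ⊤ˢ) f {Δ.id⇒} (inj₁ (Δ₊.id⇒ , tt , λ _ → ≡.refl))

  injective∈F⇒∈ : ∀ {k m} (u : Ω₊ k) (g : m Δ₊.⇒ k) → mem (F k u) m (proj₁ g) → mem u m g
  injective∈F⇒∈ u g (inj₁ (g′ , p , e)) = respects u {a = g′} {g} e p
  injective∈F⇒∈ {m = suc _} u (g , g-injective) (inj₂ (g′ , i , _ , e)) =
    contradiction (g-injective (≡.trans (≡.sym (e (inject₁ i)))
      (≡.trans (cong (fun g′) (pinch-identifies i)) (e (suc i))))) (inject₁≢suc i)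

  ∈⇒∈F : ∀ {k m} (u : Ω₊ k) (g : m Δ₊.⇒ k) → mem u m g → mem (F k u) m (proj₁ g)
  ∈⇒∈F u g p = inj₁ (g , p , λ _ → ≡.refl)

  -- The inverse of the bijection `F k`.
  nondegenerate : ∀ {k} → Ω Δ k → Ω₊ k
  nondegenerate x = record
    { mem = λ m g → mem x m (proj₁ g)
    ; respects = respects x
    ; restrict = λ f → restrict x (proj₁ f) }

  -- A sieve containing `g ∘ σ i` contains `g`, by restriction along a section of `σ i`, so
  -- induction on the dimension reaches injective maps.
  F-nondegenerate : ∀ {k} (x : Ω Δ k) → F k (nondegenerate x) ≐ˢ x
  F-nondegenerate {k} x l = to l , from l
    where
    to : ∀ l {f} → mem (F k (nondegenerate x)) l f → mem x l f
    to l (inj₁ (g , p , e)) = respects x e p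
    to (suc l) (inj₂ (g , i , p , e)) = respects x e (restrict x (σ i) (to l p))
    from : ∀ l {f} → mem x l f → mem (F k (nondegenerate x)) l f
    from l {f} p with face⊎degenerate f
    from l p | inj₁ (g , _ , e) = inj₁ (g , respects x (λ t → ≡.sym (e t)) p , e)
    from (suc l) p | inj₂ (g , i , _ , e) = inj₂ (g , i , from l (respects x
      (λ t → ≡.trans (≡.sym (e _)) (cong (fun g) (pinch-punchIn i t)))
      (restrict x (proj₁ (δ (suc i))) p)) , e)

  -- Fullness means containing the identity, which is injective, and `F` neither adds nor removes
  -- injective maps.
  jΔ-covers : ∀ {k} (w : Vector Bool (suc k)) (x : Ω Δ k) →
              (jΔ k w x ≐ˢ ⊤ˢ) ⇔ ZeroFaces w (nondegenerate x)
  jΔ-covers {k} w x = mk⇔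
    (λ p m i i≡m q f → proj₁ (Fu≐x _) (∈⇒∈F u f
      (covers.to (full₊.to (injective∈F⇒∈ (j₊ k w u) Δ₊.id⇒ (full.from p))) m i i≡m q f)))
    (λ h → full.to (∈⇒∈F (j₊ k w u) Δ₊.id⇒ (full₊.from (covers.from λ m i i≡m q f →
      injective∈F⇒∈ u f (proj₂ (Fu≐x _) (h m i i≡m q f))))))
    where
    u : Ω₊ k
    u = the ⊥ˢ λ x₊ → F k x₊ ≐ˢ x
    Fu≐x : F k u ≐ˢ x
    Fu≐x = the-satisfies ⊥ˢ (λ x₊ → F k x₊ ≐ˢ x) (nondegenerate x , F-nondegenerate x)
    module covers = Equivalence (j₊-covers w u)
    module full₊ = Equivalence (id∈⇔≐⊤ (j₊ k w u))
    module full = Equivalence (id∈⇔≐⊤ (F k (j₊ k w u)))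

  -- A map from `m` to `k` in `Δ₊` forces `m ≤ k`, so its dimension does index a letter of `w`.
  ZeroFaces⇔ContainsAll : ∀ {k} (V : Pred ℕ 0ℓ) (w : Vector Bool (suc k)) (x : Ω₊ k) →
                          (∀ i → w i ≡ false ⇔ V (toℕ i)) → ZeroFaces w x ⇔ ContainsAll V x
  ZeroFaces⇔ContainsAll V w x low = mk⇔
    (λ h m v f → h m (fromℕ< (s≤s (Δ₊⇒≤ f))) (toℕ-fromℕ< _)
      (Equivalence.from (low _) (subst V (≡.sym (toℕ-fromℕ< _)) v)) f)
    (λ h m i i≡m q → h m (subst V i≡m (Equivalence.to (low i) q)))

  -- A degenerate map from `suc m` factors through `m`, where `V` still holds by `down`; induction
  -- ends at an injective map.
  nondegenerate-ContainsAll : ∀ {k} (V : Pred ℕ 0ℓ) (x : Ω Δ k) → (∀ m → V (suc m) → V m) →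
                              ContainsAll V (nondegenerate x) ⇔ ContainsAll V x
  nondegenerate-ContainsAll V x down = mk⇔ extend (λ h m v f → h m v (proj₁ f))
    where
    extend : ContainsAll V (nondegenerate x) → ContainsAll V x
    extend h m v f with face⊎degenerate f
    extend h m v f | inj₁ (g , _ , e) = respects x e (h m v g)
    extend h (suc m) v f | inj₂ (g , i , _ , e) =
      respects x e (restrict x (σ i) (extend h m (down m v) g))

  -- Truncation to a full subcategory.

  module _ {C : Category 0ℓ 0ℓ 0ℓ} {P : Pred (Category.Ob C) 0ℓ} where
    open Category C
    private module C≤ = Category (FullSubcategory C P)

    -- The least sieve extending `x`; it witnesses that the description in `untruncate` is
    -- satisfiable.
    generate : ∀ {k} (p : P k) → Ω (FullSubcategory C P) (k , p) → Ω C k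
    generate {k} p x = record
      { mem = λ l f → Σ[ m ∈ C≤.Ob ] Σ[ g ∈ m C≤.⇒ (k , p) ]
                      mem x m g × Σ[ h ∈ l ⇒ proj₁ m ] g ∘ h ≈ f
      ; respects = λ e (m , g , q , h , e′) → m , g , q , h , Equiv.trans e′ e
      ; restrict = λ f (m , g , q , h , e) →
          m , g , q , h ∘ f , Equiv.trans (Equiv.sym assoc) (∘-resp-≈ e Equiv.refl) }

    truncate-generate : ∀ {k} (p : P k) (x : Ω (FullSubcategory C P) (k , p)) →
                        truncate {P = P} p (generate p x) ≐ˢ x
    truncate-generate p x l =
      (λ (m , g , q , h , e) → respects x e (restrict x {m} {l} h q))
      , λ {f} q → l , f , q , id⇒ , identityʳ

    truncate-untruncate : ∀ {k} (p : P k) (x : Ω (FullSubcategory C P) (k , p)) →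
                          truncate {P = P} p (untruncate {P = P} p x) ≐ˢ x
    truncate-untruncate p x = the-satisfies ⊥ˢ (λ x′ → truncate {P = P} p x′ ≐ˢ x)
      (generate p x , truncate-generate p x)

    -- Truncation keeps the identity, which detects fullness, and keeps every morphism from an
    -- object satisfying `P`.
    truncate-covers : ∀ {k} (p : P k) (x : Ω (FullSubcategory C P) (k , p))
                      (W : Pred C≤.Ob 0ℓ) (J : Ω C k → Ω C k) →
                      (∀ S → (J S ≐ˢ ⊤ˢ) ⇔ ContainsAll (λ m → Σ[ q ∈ P m ] W (m , q)) S) →
                      (truncate {P = P} p (J (untruncate {P = P} p x)) ≐ˢ ⊤ˢ) ⇔
                      ContainsAll {C = FullSubcategory C P} {k , p} W x
    truncate-covers {k} p x W J covers = mk⇔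
      (λ e m w f → proj₁ (truncate-untruncate p x m)
        (cov.to (full.to (full≤.from e)) (proj₁ m) (proj₂ m , w) f))
      (λ h → full≤.to (full.from (cov.from λ m (q , w) f →
        proj₂ (truncate-untruncate p x (m , q)) (h (m , q) w f))))
      where
      module cov = Equivalence (covers (untruncate {P = P} p x))
      module full = Equivalence (id∈⇔≐⊤ (J (untruncate {P = P} p x)))
      module full≤ = Equivalence (id∈⇔≐⊤ {C = FullSubcategory C P} {k , p}
        (truncate {P = P} p (J (untruncate {P = P} p x))))

  -- The set `W` for each of the four kinds of categories.

  letter-down : ∀ (w : StepWord) i → letter w (suc i) ≡ false → letter w i ≡ false
  letter-down 0^ω i _ = ≡.refl
  letter-down (0^ m 1^ω) i p with m ≤ᵇ i in eq
  ... | false = ≡.refl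
  ... | true = contradiction
    (Equivalence.to T-≡ (≤⇒≤ᵇ (≤-trans (≤ᵇ⇒≤ m i (Equivalence.from T-≡ eq)) (n≤1+n i))))
    (false≢true p)

  Zero : (𝒟 : Kind) → Word 𝒟 → Pred (Category.Ob (index 𝒟)) 0ℓ
  Zero (sSet₊≤ n) w (m , m≤n) = w (fromℕ< (s≤s m≤n)) ≡ false
  Zero (sSet≤ n)  r (m , _)   = letter (0^ toℕ r 1^ω) m ≡ false
  Zero sSet₊      w m         = w m ≡ false
  Zero sSet       w m         = letter w m ≡ false

  j^-covers : ∀ 𝒟 w {k} (S : Ω (index 𝒟) k) →
              (j^ lem 𝒟 w k S ≐ˢ ⊤ˢ) ⇔ ContainsAll (Zero 𝒟 w) S
  j^-covers (sSet₊≤ n) w {k , k≤n} S =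
    truncate-covers k≤n S (Zero (sSet₊≤ n) w) (j₊ k v) λ x →
      ZeroFaces⇔ContainsAll _ v x low ⇔-∘ j₊-covers v x
    where
    v : Vector Bool (suc k)
    v i = w (inject≤ i (s≤s k≤n))
    v≡w : ∀ i (q : toℕ i ≤ n) → v i ≡ w (fromℕ< (s≤s q))
    v≡w i q = cong w (toℕ-injective (≡.trans (toℕ-inject≤ i _) (≡.sym (toℕ-fromℕ< _))))
    low : ∀ i → v i ≡ false ⇔ (Σ[ q ∈ toℕ i ≤ n ] w (fromℕ< (s≤s q)) ≡ false)
    low i = mk⇔
      (λ p → let q = ≤-trans (s≤s⁻¹ (toℕ<n i)) k≤n in q , ≡.trans (≡.sym (v≡w i q)) p)
      (λ (q , p) → ≡.trans (v≡w i q) p)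
  j^-covers (sSet≤ n) r {k , k≤n} S =
    truncate-covers k≤n S (Zero (sSet≤ n) r) (jΔ k v) λ x →
      nondegenerate-ContainsAll V x down ⇔-∘
      (ZeroFaces⇔ContainsAll V v (nondegenerate x) low ⇔-∘ jΔ-covers v x)
    where
    v : Vector Bool (suc k)
    v = prefix (letter (0^ toℕ r 1^ω)) k
    V : Pred ℕ 0ℓ
    V m = Σ[ q ∈ m ≤ n ] letter (0^ toℕ r 1^ω) m ≡ false
    down : ∀ m → V (suc m) → V m
    down m (q , p) = ≤-trans (n≤1+n m) q , letter-down (0^ toℕ r 1^ω) m p
    low : ∀ i → v i ≡ false ⇔ V (toℕ i)
    low i = mk⇔ (≤-trans (s≤s⁻¹ (toℕ<n i)) k≤n ,_) proj₂
  j^-covers sSet₊ w {k} S =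
    ZeroFaces⇔ContainsAll _ (prefix w k) S (λ _ → mk⇔ id id) ⇔-∘ j₊-covers (prefix w k) S
  j^-covers sSet w {k} S =
    nondegenerate-ContainsAll _ S (letter-down w) ⇔-∘
    (ZeroFaces⇔ContainsAll _ (prefix (letter w) k) (nondegenerate S) (λ _ → mk⇔ id id) ⇔-∘
     jΔ-covers (prefix (letter w) k) S)

corollary56 :
  (lem : ∀ {ℓ} → ExcludedMiddle ℓ) (𝒟 : Kind) (w : Word 𝒟) →
    Quasitopos (Sep (index 𝒟) (j^ lem 𝒟 w)) × Quasitopos (Sh (index 𝒟) (j^ lem 𝒟 w))
corollary56 lem 𝒟 w =
  Rigid.quasitoposes (index 𝒟) (j^ lem 𝒟 w) (Zero lem 𝒟 w) (j^-covers lem 𝒟 w) lem
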